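{- Assume the following conjecture (BC) holds. (BC): for every positive integer $m$ and every non-zero polynomial $h\in\mathbb{Q}[x_3,x_5,\ldots,x_{2m+1}]$ that is homogeneous with respect to the grading $\deg(x_{2k+1})=2k+1$, there exist infinitely many primes $p$ such that $p$ does not divide the numerator of $h(B_{p-3},B_{p-5},\ldots,B_{p-2m-1})$, where $B_i$ denotes the $i$-th Bernoulli number. Then the kernel of the map $\hat{Z}:\hat{\Lambda}\to\hat{\mathcal{A}}$ is equal to the closure in $\hat{\Lambda}$ of the ideal $$I_\beta:=(\beta_0,\beta_1,\ldots)\subset\hat{\Lambda},\qquad\text{where}\qquad \beta_k:=e_k+\sum_{j=k}^{\infty}(-1)^{j+1}\binom{j}{k}e_j\in\hat{\Lambda}\quad (k\geq 0).$$
   Context: $\Lambda=\Lambda_{\mathbb{Q}}$ is the ring of symmetric functions over $\mathbb{Q}$: formal power series of bounded degree in countably many variables with rational coefficients, invariant under all permutations of the variables. $e_k$ is the $k$-th elementary symmetric function ($e_0=1$); $\Lambda$ is the free commutative $\mathbb{Q}$-algebra on $e_1,e_2,\ldots$. A symmetric function is evaluated at a finite list of rationals by setting the remaining variables to $0$. The grading by $H$-degree on $\Lambda$ is the multiplicative grading in which $e_k$ (for $k\geq 1$) is homogeneous of $H$-degree $k+1$ (constants have $H$-degree $0$). For $f=\sum_m f_m$ with $f_m$ homogeneous of $H$-degree $m$, put $v(f):=\inf\{m: f_m\neq 0\}\in\mathbb{Z}_{\geq 0}\cup\{\infty\}$, and define the ideal $\mathcal{I}_n:=\{f\in\Lambda: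 v(f)\geq n\}$. The completion is $\hat{\Lambda}:=\varprojlim_n\Lambda/\mathcal{I}_n$; its elements are formal infinite sums $\sum_{m\ge 0} f_m$ with $f_m\in\Lambda$ homogeneous of $H$-degree $m$. For $n\geq 1$ let $\mathcal{A}_n:=\left(\prod_p\mathbb{Z}/p^n\mathbb{Z}\right)/\left(\bigoplus_p\mathbb{Z}/p^n\mathbb{Z}\right)$, with $p$ ranging over all primes; an element is given by residue classes $a_p\in\mathbb{Z}/p^n\mathbb{Z}$ for all but finitely many $p$, two families being identified if they agree for all but finitely many $p$. For $f\in\Lambda$ and all sufficiently large primes $p$, $f(p/1,p/2,\ldots,p/(p-1))\in\mathbb{Z}_{(p)}$; reducing modulo $p^n$ gives a ring homomorphism $Z^{[n]}:\Lambda\to\mathcal{A}_n$. It is known that $Z^{[n]}$ vanishes on $\mathcal{I}_n$ (since $e_k(p/1,\ldots,p/(p-1))\equiv 0 \bmod p^{k+1}$ for each fixed $k\geq 1$ and all large $p$), so it induces $\tilde{Z}^{[n]}:\Lambda/\mathcal{I}_n\to\mathcal{A}_n$. These maps are compatible with the quotient maps as $n$ varies, and $\hat{Z}:\hat{\Lambda}\to\hat{\mathcal{A}}:=\varprojlim_n\mathcal{A}_n$ is the induced map on projective limits. Each $\mathcal{A}_n$ and $\Lambda/\mathcal{I}_n$ has the discrete topology, and $\hat{\mathcal{A}}$ and $\hat{\Lambda}$ have the projective limit topologies. Concretely, $\sum_m f_m\in\ker\hat{Z}$ if and only if for every $N\geq 0$ the congruence $\sum_{m<N}f_m(p/1,\ldots,p/(p-1))\equiv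 0\bmod p^N$ (in $\mathbb{Z}_{(p)}$) holds for all sufficiently large primes $p$. The numerator of a rational number refers to its expression in lowest terms. -}

module Defs where

open import Algebra.Bundles using (CommutativeRing)
open import Data.Bool.Base using (if_then_else_)
open import Data.Fin.Base using (Fin; toℕ)
open import Data.Integer.Base as ℤ using (+_; ∣_∣)
import Data.Integer.Properties as ℤ
open import Data.List.Base using (List; []; _∷_; map; upTo)
open import Data.List.Membership.Propositional.Properties using (∈-upTo⁻)
open import Data.List.Relation.Unary.All as All using (All; []; _∷_)
import Data.List.Relation.Unary.All.Properties as All
open import Data.Nat.Base as ℕ using (ℕ; zero; suc; _∸_; _^_; _≤_; _<_; z≤n; s≤s)
open import Data.Nat.Combinatorics using (_C_)
open import Data.Nat.Divisibility using (_∣_; ∣-trans; ∣⇒≤; m∣m*n)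
open import Data.Nat.Primality using (Prime; euclidsLemma; prime⇒nonTrivial)
import Data.Nat.Properties as ℕ
open import Data.Product.Base using (_×_; _,_; ∃-syntax)
open import Data.Rational.Base as ℚ using (ℚ; 0ℚ; 1ℚ; ↥_; ↧_; ↧ₙ_; _/_)
import Data.Rational.Properties as ℚ
open import Data.Sum.Base using ([_,_]′)
open import Data.Vec.Base as Vec using (Vec; []; _∷ʳ_; last; lookup)
open import Function.Base using (_∘_)
open import Level using (0ℓ)
open import Relation.Binary.PropositionalEquality.Core using (_≡_; refl; sym; subst)
open import Relation.Nullary.Decidable using (does; dec-false)
open import Relation.Nullary.Negation using (¬_)
open import Relation.Unary using (Pred)

infixl 6 _+_
infixl 7 _*_
infix  8 -_
infix  4 _≈_

-- The free commutative ℚ-algebra on X: terms, modulo the congruence generated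
-- by the ring laws and the laws making `const` a ring homomorphism.
data Poly (X : Set) : Set where
  const   : ℚ → Poly X
  var     : X → Poly X
  _+_ _*_ : Poly X → Poly X → Poly X
  -_      : Poly X → Poly X

0# : ∀ {X} → Poly X
0# = const 0ℚ

1# : ∀ {X} → Poly X
1# = const 1ℚ

data _≈_ {X : Set} : Poly X → Poly X → Set where
  ≈-refl  : ∀ {f} → f ≈ f
  ≈-sym   : ∀ {f g} → f ≈ g → g ≈ f
  ≈-trans : ∀ {f g h} → f ≈ g → g ≈ h → f ≈ h

  +-cong  : ∀ {f f′ g g′} → f ≈ f′ → g ≈ g′ → f + g ≈ f′ + g′
  *-cong  : ∀ {f f′ g g′} → f ≈ f′ → g ≈ g′ → f * g ≈ f′ * g′
  -‿cong  : ∀ {f f′} → f ≈ f′ → - f ≈ - f′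

  +-assoc     : ∀ f g h → (f + g) + h ≈ f + (g + h)
  +-comm      : ∀ f g → f + g ≈ g + f
  +-identityˡ : ∀ f → 0# + f ≈ f
  -‿inverseˡ  : ∀ f → - f + f ≈ 0#
  *-assoc     : ∀ f g h → (f * g) * h ≈ f * (g * h)
  *-comm      : ∀ f g → f * g ≈ g * f
  *-identityˡ : ∀ f → 1# * f ≈ f
  distribʳ    : ∀ f g h → (g + h) * f ≈ g * f + h * f

  const-+ : ∀ a b → const (a ℚ.+ b) ≈ const a + const b
  const-* : ∀ a b → const (a ℚ.* b) ≈ const a * const b

Poly-commutativeRing : Set → CommutativeRing 0ℓ 0ℓ
Poly-commutativeRing X = record
  { Carrier = Poly X ; _≈_ = _≈_ ; _+_ = _+_ ; _*_ = _*_ ; -_ = -_ ; 0# = 0# ; 1# = 1#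
  ; isCommutativeRing = record
    { isRing = record
      { +-isAbelianGroup = record
        { isGroup = record
          { isMonoid = record
            { isSemigroup = record
              { isMagma = record
                { isEquivalence = record { refl = ≈-refl ; sym = ≈-sym ; trans = ≈-trans }
                ; ∙-cong = +-cong }
              ; assoc = +-assoc }
            ; identity = +-identityˡ , λ f → ≈-trans (+-comm f 0#) (+-identityˡ f) }
          ; inverse = -‿inverseˡ , λ f → ≈-trans (+-comm f (- f)) (-‿inverseˡ f)
          ; ⁻¹-cong = -‿cong }
        ; comm = +-comm }
      ; *-cong = *-cong
      ; *-assoc = *-assoc
      ; *-identity = *-identityˡ , λ f → ≈-trans (*-comm f 1#) (*-identityˡ f)
      ; distrib =
          (λ f g h → ≈-trans (*-comm f (g + h))
            (≈-trans (distribʳ f g h) (+-cong (*-comm g f) (*-comm h f))))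
          , distribʳ }
    ; *-comm = *-comm }
  }

module R {X : Set} = CommutativeRing (Poly-commutativeRing X)

eval : ∀ {X} → (X → ℚ) → Poly X → ℚ
eval ρ (const c) = c
eval ρ (var x)   = ρ x
eval ρ (f + g)   = eval ρ f ℚ.+ eval ρ g
eval ρ (f * g)   = eval ρ f ℚ.* eval ρ g
eval ρ (- f)     = ℚ.- eval ρ f

-- cauchy a b m = Σ_{i+j=m} a i * b j
cauchy : ∀ {X} → (ℕ → Poly X) → (ℕ → Poly X) → ℕ → Poly X
cauchy a b zero    = a 0 * b 0
cauchy a b (suc m) = a 0 * b (suc m) + cauchy (a ∘ suc) b m

-- The part of degree m of a polynomial, for the multiplicative grading in
-- which the variable x is homogeneous of degree w x.
component : ∀ {X} → (X → ℕ) → Poly X → ℕ → Poly X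
component w (const c) zero    = const c
component w (const c) (suc m) = 0#
component w (var x)   m       = if does (w x ℕ.≟ m) then var x else 0#
component w (f + g)   m       = component w f m + component w g m
component w (f * g)   m       = cauchy (component w f) (component w g) m
component w (- f)     m       = - component w f m

Homogeneous : ∀ {X} → (X → ℕ) → ℕ → Pred (Poly X) 0ℓ
Homogeneous w d f = component w f d ≈ f

Σ< : ∀ {X} → ℕ → (ℕ → Poly X) → Poly X
Σ< zero    u = 0#
Σ< (suc n) u = Σ< n u + u n

-- Λ is represented as the free commutative ℚ-algebra on e₁, e₂, …;
-- the variable with index k stands for e_{k+1}.
Λ : Set
Λ = Poly ℕ

e : ℕ → Λ
e zero    = 1#
e (suc k) = var k

-- e_{k+1} has H-degree k+2.
Hdeg : ℕ → ℕ
Hdeg k = 2 ℕ.+ k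

-- esym k xs = e_k(xs, 0, 0, …), splitting the k-element subsets of the
-- positions according to whether they contain the first one.
esym : ℕ → List ℚ → ℚ
esym zero    xs       = 1ℚ
esym (suc k) []       = 0ℚ
esym (suc k) (x ∷ xs) = x ℚ.* esym k xs ℚ.+ esym (suc k) xs

evalAt : List ℚ → Λ → ℚ
evalAt xs = eval (λ k → esym (suc k) xs)

-- 𝓘 n f says v(f) ≥ n.
𝓘 : ℕ → Pred Λ 0ℓ
𝓘 n f = ∀ m → m < n → component Hdeg f m ≈ 0#

infix 4 _≡_mod𝓘_
_≡_mod𝓘_ : Λ → Λ → ℕ → Set
f ≡ g mod𝓘 n = 𝓘 n (f + - g)

-- The inverse limit of the rings Λ/𝓘 n; each `at n` is a representative of
-- a class in Λ/𝓘 n.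
record Λ̂ : Set where
  field
    at       : ℕ → Λ
    coherent : ∀ n → at (suc n) ≡ at n mod𝓘 n
open Λ̂ public

infix 4 _≈̂_
_≈̂_ : Λ̂ → Λ̂ → Set
f ≈̂ g = ∀ n → at f n ≡ at g n mod𝓘 n

≈⇒diff≈0 : ∀ {X} {f g : Poly X} → f ≈ g → f + - g ≈ 0#
≈⇒diff≈0 {g = g} f≈g = R.trans (R.+-congʳ f≈g) (R.-‿inverseʳ g)

diff≈0⇒≈ : ∀ {X} {f g : Poly X} → f + - g ≈ 0# → f ≈ g
diff≈0⇒≈ {f = f} {g} d =
  R.trans (R.sym (R.+-identityʳ f))
  (R.trans (R.+-congˡ (R.sym (R.-‿inverseˡ g)))
  (R.trans (R.sym (R.+-assoc f (- g) g))
  (R.trans (R.+-congʳ d) (R.+-identityˡ g))))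

cauchy-cong : ∀ {X} {a a′ b b′ : ℕ → Poly X} m →
              (∀ i → i ≤ m → a i ≈ a′ i) → (∀ i → i ≤ m → b i ≈ b′ i) →
              cauchy a b m ≈ cauchy a′ b′ m
cauchy-cong zero    p q = *-cong (p 0 z≤n) (q 0 z≤n)
cauchy-cong (suc m) p q = +-cong (*-cong (p 0 z≤n) (q (suc m) ℕ.≤-refl))
  (cauchy-cong m (λ i i≤m → p (suc i) (s≤s i≤m)) (λ i i≤m → q i (ℕ.m≤n⇒m≤1+n i≤m)))

cauchy-zeroʳ : ∀ {X} (a b : ℕ → Poly X) m → (∀ i → i ≤ m → b i ≈ 0#) →
               cauchy a b m ≈ 0#
cauchy-zeroʳ a b zero    q = R.trans (R.*-congˡ (q 0 z≤n)) (R.zeroʳ (a 0))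
cauchy-zeroʳ a b (suc m) q = R.trans
  (+-cong (R.trans (R.*-congˡ (q (suc m) ℕ.≤-refl)) (R.zeroʳ (a 0)))
          (cauchy-zeroʳ (a ∘ suc) b m (λ i i≤m → q i (ℕ.m≤n⇒m≤1+n i≤m))))
  (R.+-identityˡ 0#)

𝓘-*ʳ : ∀ n f {g} → 𝓘 n g → 𝓘 n (f * g)
𝓘-*ʳ n f {g} g∈ m m<n = cauchy-zeroʳ (component Hdeg f) (component Hdeg g) m
  (λ i i≤m → g∈ i (ℕ.≤-<-trans i≤m m<n))

e∈𝓘 : ∀ j → 𝓘 j (e j)
e∈𝓘 (suc k) m m<j
  rewrite dec-false (Hdeg k ℕ.≟ m) (λ eq → ℕ.<-irrefl (sym eq) (ℕ.<-trans m<j (ℕ.n<1+n _)))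
  = ≈-refl

ι : Λ → Λ̂
ι f .at       n     = f
ι f .coherent n m _ = ≈⇒diff≈0 ≈-refl

infixl 6 _+̂_
_+̂_ : Λ̂ → Λ̂ → Λ̂
(f +̂ g) .at n = at f n + at g n
(f +̂ g) .coherent n m m<n =
  ≈⇒diff≈0 (+-cong (diff≈0⇒≈ (coherent f n m m<n)) (diff≈0⇒≈ (coherent g n m m<n)))

infixl 7 _*̂_
_*̂_ : Λ̂ → Λ̂ → Λ̂
(f *̂ g) .at n = at f n * at g n
(f *̂ g) .coherent n m m<n = ≈⇒diff≈0 (cauchy-cong m
  (λ i i≤m → diff≈0⇒≈ (coherent f n i (ℕ.≤-<-trans i≤m m<n)))
  (λ i i≤m → diff≈0⇒≈ (coherent g n i (ℕ.≤-<-trans i≤m m<n))))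

-- The infinite sum Σ_{i≥0} u i, which converges because u i ∈ 𝓘 i.
Σ∞ : (u : ℕ → Λ) → (∀ i → 𝓘 i (u i)) → Λ̂
Σ∞ u u∈ .at n = Σ< n u
Σ∞ u u∈ .coherent n m m<n =
  ≈⇒diff≈0 (R.trans (R.+-congˡ (u∈ n m m<n)) (R.+-identityʳ _))

-- The ideal of Λ̂ generated by a family.
data ⟨_⟩ {J : Set} (u : J → Λ̂) : Pred Λ̂ 0ℓ where
  gen  : ∀ j → ⟨ u ⟩ (u j)
  zero : ⟨ u ⟩ (ι 0#)
  add  : ∀ {f g} → ⟨ u ⟩ f → ⟨ u ⟩ g → ⟨ u ⟩ (f +̂ g)
  mul  : ∀ f {g} → ⟨ u ⟩ g → ⟨ u ⟩ (f *̂ g)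
  resp : ∀ {f g} → f ≈̂ g → ⟨ u ⟩ f → ⟨ u ⟩ g

-- The quotients Λ/𝓘 n being discrete, the sets {g | g ≡ f mod 𝓘 n}, n ∈ ℕ,
-- form a neighbourhood basis of f.
Closure : Pred Λ̂ 0ℓ → Pred Λ̂ 0ℓ
Closure S f = ∀ n → ∃[ g ] (S g × at g n ≡ at f n mod𝓘 n)

-1^_ : ℕ → ℚ
-1^ zero  = 1ℚ
-1^ suc n = ℚ.- (-1^ n)

βterm : ℕ → ℕ → Λ
βterm k j = const ((-1^ suc j) ℚ.* (+ (j C k) / 1)) * e j

-- The sum over j ≥ k is reindexed by j = k + i.
β : ℕ → Λ̂
β k = ι (e k) +̂ Σ∞ (λ i → βterm k (k ℕ.+ i)) λ i →
  𝓘-*ʳ i (const ((-1^ suc (k ℕ.+ i)) ℚ.* (+ ((k ℕ.+ i) C k) / 1))) {e (k ℕ.+ i)} λ m m<i → e∈𝓘 (k ℕ.+ i) m (ℕ.<-≤-trans m<i (ℕ.m≤n+m i k))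

Iβ : Pred Λ̂ 0ℓ
Iβ = ⟨ β ⟩

-- For all but finitely many primes.
Eventually : Pred ℕ 0ℓ → Set
Eventually P = ∃[ N ] (∀ p → Prime p → N ≤ p → P p)

-- x ∈ ℤ_(p); the denominator ↧ₙ x is the one in lowest terms.
Integral : ℕ → Pred ℚ 0ℓ
Integral p x = ¬ (p ∣ ↧ₙ x)

-- x ≡ y mod p^n in ℤ_(p), i.e. x - y ∈ p^n ℤ_(p).
infix 4 _≡_mod_^_
_≡_mod_^_ : ℚ → ℚ → ℕ → ℕ → Set
x ≡ y mod p ^ n = Integral p (x ℚ.- y) × (p ℕ.^ n ∣ ∣ ↥ (x ℚ.- y) ∣)

-- ℤ/p^n is taken in the form ℤ_(p)/p^n ℤ_(p). Only the values of `residue`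
-- at all but finitely many primes matter.
record 𝒜 (n : ℕ) : Set where
  field
    residue  : ℕ → ℚ
    integral : Eventually λ p → Integral p (residue p)
open 𝒜 public

infix 4 _≈𝒜_
_≈𝒜_ : ∀ {n} → 𝒜 n → 𝒜 n → Set
_≈𝒜_ {n} a b = Eventually λ p → residue a p ≡ residue b p mod p ^ n

∤1 : ∀ {p} → Prime p → ¬ (p ∣ 1)
∤1 pr p∣1 = ℕ.<⇒≱ (ℕ.nonTrivial⇒n>1 _ {{prime⇒nonTrivial pr}}) (∣⇒≤ p∣1)

abs-∣ : ∀ d i {c} → d ℤ.* i ≡ c → ∣ d ∣ ∣ ∣ c ∣
abs-∣ d i refl = subst (∣ d ∣ ∣_) (sym (ℤ.abs-* d i)) (m∣m*n ∣ i ∣)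

integral-product : ∀ {p} x y z → Prime p → ↧ₙ z ∣ ↧ₙ x ℕ.* ↧ₙ y →
                   Integral p x → Integral p y → Integral p z
integral-product x y z pr z∣xy px py p∣z =
  [ px , py ]′ (euclidsLemma (↧ₙ x) (↧ₙ y) pr (∣-trans p∣z z∣xy))

integral-+ : ∀ {p} x y → Prime p → Integral p x → Integral p y → Integral p (x ℚ.+ y)
integral-+ x y pr = integral-product x y (x ℚ.+ y) pr
  (subst (↧ₙ (x ℚ.+ y) ∣_) (ℤ.abs-* (↧ x) (↧ y)) (abs-∣ (↧ (x ℚ.+ y)) _ (ℚ.↧-+ x y)))

integral-* : ∀ {p} x y → Prime p → Integral p x → Integral p y → Integral p (x ℚ.* y)
integral-* x y pr = integral-product x y (x ℚ.* y) pr
  (subst (↧ₙ (x ℚ.* y) ∣_) (ℤ.abs-* (↧ x) (↧ y)) (abs-∣ (↧ (x ℚ.* y)) _ (ℚ.↧-* x y)))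

integral-neg : ∀ {p} x → Integral p x → Integral p (ℚ.- x)
integral-neg {p} x px = px ∘ subst (λ d → p ∣ ∣ d ∣) (ℚ.↧-neg x)

integral-esym : ∀ {p} → Prime p → ∀ k {xs} → All (Integral p) xs → Integral p (esym k xs)
integral-esym pr zero    _  = ∤1 pr
integral-esym pr (suc k) [] = ∤1 pr
integral-esym pr (suc k) {x ∷ xs} (px ∷ pxs) =
  integral-+ (x ℚ.* esym k xs) (esym (suc k) xs) pr
    (integral-* x (esym k xs) pr px (integral-esym pr k pxs))
    (integral-esym pr (suc k) pxs)

integral-fraction : ∀ {p} i n .{{_ : ℕ.NonZero n}} → n < p → Integral p (i / n)
integral-fraction i n n<p p∣ = ℕ.<⇒≱ n<p (∣⇒≤ (∣-trans p∣ (abs-∣ (↧ (i / n)) _ (ℚ.↧-/ i n))))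

-- p/1, p/2, …, p/(p-1)
points : ℕ → List ℚ
points p = map (λ i → + p / suc i) (upTo (p ∸ 1))

integral-points : ∀ p → All (Integral p) (points p)
integral-points zero    = []
integral-points (suc q) = All.map⁺ (All.tabulate λ {i} i∈ →
  integral-fraction (+ suc q) (suc i) (s≤s (∈-upTo⁻ i∈)))

integral-evalAt : ∀ f → Eventually λ p → Integral p (evalAt (points p) f)
integral-evalAt (const c) =
  suc (↧ₙ c) , λ p _ c<p p∣c → ℕ.<⇒≱ c<p (∣⇒≤ p∣c)
integral-evalAt (var k) = 0 , λ p pr _ → integral-esym pr (suc k) (integral-points p)
integral-evalAt (f + g) with integral-evalAt f | integral-evalAt g
... | M , F | N , G = M ℕ.+ N , λ p pr b →
  integral-+ (evalAt (points p) f) (evalAt (points p) g) pr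
    (F p pr (ℕ.m+n≤o⇒m≤o M b)) (G p pr (ℕ.m+n≤o⇒n≤o M b))
integral-evalAt (f * g) with integral-evalAt f | integral-evalAt g
... | M , F | N , G = M ℕ.+ N , λ p pr b →
  integral-* (evalAt (points p) f) (evalAt (points p) g) pr
    (F p pr (ℕ.m+n≤o⇒m≤o M b)) (G p pr (ℕ.m+n≤o⇒n≤o M b))
integral-evalAt (- f) with integral-evalAt f
... | M , F = M , λ p pr b → integral-neg (evalAt (points p) f) (F p pr b)

Z[_] : ∀ n → Λ → 𝒜 n
Z[ n ] f .residue p = evalAt (points p) f
Z[ n ] f .integral  = integral-evalAt f

-- The limit of the 𝒜 n is the subring of compatible sequences in their
-- product; Ẑ is given as the map into the product, whose kernel is the same.
Ẑ : Λ̂ → (n : ℕ) → 𝒜 n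
Ẑ f n = Z[ n ] (at f n)

KerẐ : Pred Λ̂ 0ℓ
KerẐ f = ∀ n → Ẑ f n ≈𝒜 Z[ n ] 0#

-- bernoullis n = B₀, …, B_{n-1}, by B_n = [n = 0] - Σ_{j<n} (n+1 C j) B_j / (n+1).
bernoulliStep : ∀ n → Vec ℚ n → ℚ
bernoulliStep zero    _  = 1ℚ
bernoulliStep (suc n) bs =
  ℚ.- ((+ 1 / (2 ℕ.+ n)) ℚ.*
    Vec.foldr′ ℚ._+_ 0ℚ (Vec.tabulate λ j → (+ ((2 ℕ.+ n) C toℕ j) / 1) ℚ.* lookup bs j))

bernoullis : ∀ n → Vec ℚ n
bernoullis zero    = []
bernoullis (suc n) = bernoullis n ∷ʳ bernoulliStep n (bernoullis n)

B : ℕ → ℚ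
B n = last (bernoullis (suc n))

-- The variable with index i : Fin m stands for x_{2i+3}, of degree 2i+3.
label : ∀ {m} → Fin m → ℕ
label i = 3 ℕ.+ 2 ℕ.* toℕ i

-- The truncated subtraction is only off for the finitely many p < 2m+1.
BC : Set
BC = ∀ m → 1 ≤ m → (h : Poly (Fin m)) → ¬ (h ≈ 0#) → (∃[ d ] Homogeneous label d h) →
     ∀ N → ∃[ p ] (N ≤ p × Prime p × ¬ (p ∣ ∣ ↥ eval (λ i → B (p ∸ label i)) h ∣))

module Submission where

-- Write s_k for e_k(1, 1/2, …, 1/(p-1)), so that e_k takes the value p^k s_k at
-- the points p/1, …, p/(p-1). The involution x ↦ x/(x-1) of these points shows
-- that each β_k takes the value 0 (for p > 2). Comparing coefficients in
-- (t+1) F(t+1) = (t+p) F(t) for F(t) = Π (1 + t/i) shows that p ∣ s_k for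
-- 1 ≤ k ≤ p-2, and that (k+1) s_k ≡ -p B_{p-1-k} mod p² for even k, since the
-- Bernoulli recurrence is the same triangular system up to terms divisible by p².
-- Hence Ẑ kills the closure of I_β. Conversely, β_{2r} eliminates e_{2r+1}, so
-- that modulo I_β and 𝓘 n every f is a polynomial r in e_2, e_4, …; if f lies in
-- the kernel, the value of the lowest component of r at Bernoulli numbers is
-- divisible by p for all large p, so that this component is zero by (BC).

open import Defs
open import Algebra.Bundles using (CommutativeRing)
import Algebra.Properties.Ring as RingProperties
import Algebra.Solver.Ring.NaturalCoefficients.Default as NaturalCoefficients
open import Data.Bool.Base using (true; false; if_then_else_)
open import Data.Fin.Base as Fin using (Fin; toℕ; fromℕ<)
import Data.Fin.Properties as Fin
open import Data.Integer.Base as ℤ using (+_; ∣_∣)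
import Data.Integer.Divisibility.Signed as Signed
import Data.Integer.Properties as ℤ
open import Data.List.Base as List using (List; []; _∷_; _++_; map; upTo; downFrom; applyUpTo; length)
open import Data.List.Membership.Propositional.Properties using (∈-upTo⁻)
import Data.List.Properties as List
open import Data.List.Relation.Binary.Permutation.Propositional as Perm using (_↭_; ↭-sym; ↭-trans; ↭-reflexive)
import Data.List.Relation.Binary.Permutation.Propositional.Properties as Perm
open import Data.List.Relation.Unary.All as All using (All; []; _∷_)
import Data.List.Relation.Unary.All.Properties as All
open import Data.Nat.Base as ℕ using (ℕ; zero; suc; _∸_; _≤_; _<_; z≤n; s≤s; _!)
open import Data.Nat.Combinatorics
  using (_C_; nCk+nC[k+1]≡[n+1]C[k+1]; k>n⇒nCk≡0; nCn≡1; nC1≡n; nCk≡nC[n∸k]; nCk≡n!/k![n-k]!; k![n∸k]!∣n!)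
open import Data.Nat.Coprimality using (Coprime; coprime-divisor)
open import Data.Nat.Divisibility using (_∣_; divides; ∣1⇒≡1; ∣-trans; ∣⇒≤; m∣m*n)
open import Data.Nat.DivMod using (m/n*n≡m)
open import Data.Nat.Primality using (Prime; euclidsLemma; prime⇒nonZero; prime⇒irreducible; ¬prime[1])
import Data.Nat.Properties as ℕ
import Data.Nat.Solver as ℕ
open import Data.Product.Base using (_×_; _,_; ∃-syntax; proj₁; proj₂)
open import Data.Rational.Base as ℚ using (ℚ; 0ℚ; 1ℚ; ↥_; ↧_; ↧ₙ_; _/_)
import Data.Rational.Properties as ℚ
open import Data.Rational.Solver using (module +-*-Solver)
import Data.Rational.Unnormalised.Base as ℚᵘ
import Data.Rational.Unnormalised.Properties as ℚᵘ
open import Data.Sum.Base using (_⊎_; inj₁; inj₂)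
open import Data.Unit.Base using (⊤; tt)
open import Data.Vec.Base as Vec using (Vec; []; _∷_; lookup)
import Data.Vec.Properties as Vec
open import Function.Base using (_∘_; _$_)
open import Level using (0ℓ)
open import Relation.Binary.PropositionalEquality
  using (_≡_; _≢_; refl; sym; trans; cong; cong₂; subst; module ≡-Reasoning)
open import Relation.Nullary.Decidable using (yes; no; decidable-stable)
open import Relation.Nullary.Negation using (¬_; contradiction)
open import Relation.Unary using (Pred; _⊆_; _≐_)

open +-*-Solver using (solve; _:=_; _:+_; _:*_; _:-_; :-_; con)

-- The linear system read off from (t+1) F(t+1) = (t+p) F(t) is used twice. Its right-hand sides p
-- s_k are multiples of p, which gives p ∣ s_k; they are then multiples of p², so that up to p² the
-- s_k solve the homogeneous system. A solution of that system is determined by its top entry, and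
-- the coefficients of (B_p(t) - B_p)/t form an exact one, because B_p(t+1) - B_p(t) = p t^(p-1). So
-- s_k is s_{p-1} times this solution modulo p², and s_{p-1} ≡ -1 mod p by Wilson's theorem. The
-- closure only asks for an approximation at each level n, so everything is done modulo 𝓘 n, where
-- finitely many of the even e_k are left, as (BC) requires. The obstacle in the last step is
-- logical: (BC) speaks of polynomials h with ¬ (h ≈ 0#), so it refutes only this negation and
-- yields ¬¬ (h ≈ 0#). Removing the double negation needs an argument about the free algebra itself,
-- by induction on the number of variables down to the decidable equality of ℚ.

private
  variable
    X Y : Set

-- Natural numbers as rationals, and p-adic divisibility in ℚ

infix 9 _/1
_/1 : ℕ → ℚ
n /1 = + n / 1

private
  toℚᵘ-/1 : ∀ n → ℚ.toℚᵘ (n /1) ℚᵘ.≃ (+ n ℚᵘ./ 1)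
  toℚᵘ-/1 n = ℚ.toℚᵘ-fromℚᵘ (ℚᵘ.mkℚᵘ (+ n) 0)

/1-+ : ∀ m n → (m ℕ.+ n) /1 ≡ m /1 ℚ.+ n /1
/1-+ m n = ℚ.toℚᵘ-injective (ℚᵘ.≃-trans (toℚᵘ-/1 (m ℕ.+ n))
  (ℚᵘ.≃-sym (ℚᵘ.≃-trans (ℚ.toℚᵘ-homo-+ (m /1) (n /1))
    (ℚᵘ.≃-trans (ℚᵘ.+-cong (toℚᵘ-/1 m) (toℚᵘ-/1 n))
      (ℚᵘ.*≡* (cong (ℤ._* (+ 1)) (trans (cong₂ ℤ._+_ (ℤ.*-identityʳ (+ m)) (ℤ.*-identityʳ (+ n))) refl)))))))

/1-* : ∀ m n → (m ℕ.* n) /1 ≡ m /1 ℚ.* n /1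
/1-* m n = ℚ.toℚᵘ-injective (ℚᵘ.≃-trans (toℚᵘ-/1 (m ℕ.* n))
  (ℚᵘ.≃-sym (ℚᵘ.≃-trans (ℚ.toℚᵘ-homo-* (m /1) (n /1))
    (ℚᵘ.≃-trans (ℚᵘ.*-cong (toℚᵘ-/1 m) (toℚᵘ-/1 n))
      (ℚᵘ.*≡* (cong (ℤ._* (+ 1)) (sym (ℤ.pos-* m n))))))))

/-as-* : ∀ m n → + m / suc n ≡ m /1 ℚ.* (+ 1 / suc n)
/-as-* m n = ℚ.toℚᵘ-injective (ℚᵘ.≃-trans (ℚ.toℚᵘ-fromℚᵘ (ℚᵘ.mkℚᵘ (+ m) n))
  (ℚᵘ.≃-sym (ℚᵘ.≃-trans (ℚ.toℚᵘ-homo-* (m /1) (+ 1 / suc n))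
    (ℚᵘ.≃-trans (ℚᵘ.*-cong (toℚᵘ-/1 m) (ℚ.toℚᵘ-fromℚᵘ (ℚᵘ.mkℚᵘ (+ 1) n)))
      (ℚᵘ.*≡* (cong₂ ℤ._*_ (ℤ.*-identityʳ (+ m)) (cong +_ (sym (ℕ.+-identityʳ (suc n))))))))))

/1-inverse : ∀ n → suc n /1 ℚ.* (+ 1 / suc n) ≡ 1ℚ
/1-inverse n = trans (sym (/-as-* (suc n) n)) (ℚ.toℚᵘ-injective
  (ℚᵘ.≃-trans (ℚ.toℚᵘ-fromℚᵘ (ℚᵘ.mkℚᵘ (+ suc n) n)) (ℚᵘ.*≡* (ℤ.*-comm (+ suc n) (+ 1)))))

integral-/1 : ∀ {p} n → Prime p → Integral p (n /1)
integral-/1 n pr p∣ = ∤1 pr (∣-trans p∣ (abs-∣ (↧ (n /1)) _ (ℚ.↧-/ (+ n) 1)))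

infix 4 _^_∣ᵖ_
-- With an explicit cofactor, sums and products of multiples of p^n are handled by ring identities.
-- The form with numerators in lowest terms appears only at the two ends of the proof, through
-- `∣ᵖ⇒∣↥` and `∣↥⇒∣ᵖ`.
record _^_∣ᵖ_ (p n : ℕ) (x : ℚ) : Set where
  constructor multiple
  field
    cofactor          : ℚ
    cofactor-integral : Integral p cofactor
    equation          : x ≡ (p ℕ.^ n) /1 ℚ.* cofactor

module _ {p} (pr : Prime p) where

  integral⇒∣ᵖ : ∀ {x} → Integral p x → p ^ 0 ∣ᵖ x
  integral⇒∣ᵖ {x} i = multiple x i $ sym (ℚ.*-identityˡ x)

  ∣ᵖ⇒integral : ∀ {n x} → p ^ n ∣ᵖ x → Integral p x
  ∣ᵖ⇒integral {n} (multiple y i refl) = integral-* ((p ℕ.^ n) /1) y pr (integral-/1 (p ℕ.^ n) pr) i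

  ∣ᵖ-0 : ∀ n → p ^ n ∣ᵖ 0ℚ
  ∣ᵖ-0 n = multiple 0ℚ (∤1 pr) $ sym (ℚ.*-zeroʳ ((p ℕ.^ n) /1))

  ∣ᵖ-+ : ∀ {n x y} → p ^ n ∣ᵖ x → p ^ n ∣ᵖ y → p ^ n ∣ᵖ x ℚ.+ y
  ∣ᵖ-+ {n} (multiple a i refl) (multiple b j refl) =
    multiple (a ℚ.+ b) (integral-+ a b pr i j) $ sym (ℚ.*-distribˡ-+ ((p ℕ.^ n) /1) a b)

  ∣ᵖ-neg : ∀ {n x} → p ^ n ∣ᵖ x → p ^ n ∣ᵖ ℚ.- x
  ∣ᵖ-neg {n} (multiple a i refl) =
    multiple (ℚ.- a) (integral-neg a i) $ solve 2 (λ q a → :- (q :* a) := q :* (:- a)) refl ((p ℕ.^ n) /1) a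

  ∣ᵖ-minus : ∀ {n x y} → p ^ n ∣ᵖ x → p ^ n ∣ᵖ y → p ^ n ∣ᵖ x ℚ.- y
  ∣ᵖ-minus d e = ∣ᵖ-+ d (∣ᵖ-neg e)

  ∣ᵖ-* : ∀ {m n x y} → p ^ m ∣ᵖ x → p ^ n ∣ᵖ y → p ^ m ℕ.+ n ∣ᵖ x ℚ.* y
  ∣ᵖ-* {m} {n} (multiple a i refl) (multiple b j refl) = multiple (a ℚ.* b) (integral-* a b pr i j) $
    trans (solve 4 (λ q a r b → (q :* a) :* (r :* b) := (q :* r) :* (a :* b)) refl ((p ℕ.^ m) /1) a ((p ℕ.^ n) /1) b)
      (cong (ℚ._* (a ℚ.* b)) (sym (trans (cong _/1 (ℕ.^-distribˡ-+-* p m n)) (/1-* (p ℕ.^ m) (p ℕ.^ n)))))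

  ∣ᵖ-*ˡ : ∀ {n} x {y} → Integral p x → p ^ n ∣ᵖ y → p ^ n ∣ᵖ x ℚ.* y
  ∣ᵖ-*ˡ x i d = ∣ᵖ-* (integral⇒∣ᵖ {x} i) d

  ∣ᵖ-*ʳ : ∀ {n x} y → p ^ n ∣ᵖ x → Integral p y → p ^ n ∣ᵖ x ℚ.* y
  ∣ᵖ-*ʳ {n} {x} y d i = subst (p ^ n ∣ᵖ_) (ℚ.*-comm y x) (∣ᵖ-*ˡ y i d)

  ^∣ᵖ^ : ∀ n → p ^ n ∣ᵖ (p ℕ.^ n) /1
  ^∣ᵖ^ n = multiple 1ℚ (∤1 pr) $ sym (ℚ.*-identityʳ ((p ℕ.^ n) /1))

  ∣ᵖ-weaken : ∀ {m n x} → m ≤ n → p ^ n ∣ᵖ x → p ^ m ∣ᵖ x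
  ∣ᵖ-weaken {m} {n} m≤n (multiple a i refl) = subst (λ k → p ^ m ∣ᵖ (p ℕ.^ k) /1 ℚ.* a) (ℕ.m+[n∸m]≡n m≤n)
    (subst (λ z → p ^ m ∣ᵖ z ℚ.* a) (sym (trans (cong _/1 (ℕ.^-distribˡ-+-* p m (n ℕ.∸ m))) (/1-* (p ℕ.^ m) _)))
      (∣ᵖ-*ʳ a (∣ᵖ-*ʳ ((p ℕ.^ (n ℕ.∸ m)) /1) (^∣ᵖ^ m) (integral-/1 (p ℕ.^ (n ℕ.∸ m)) pr)) i))

  *-cancelˡ-^ : ∀ n {x y} → (p ℕ.^ n) /1 ℚ.* x ≡ (p ℕ.^ n) /1 ℚ.* y → x ≡ y
  *-cancelˡ-^ n {x} {y} eq with p ℕ.^ n | ℕ.m^n≢0 p n {{prime⇒nonZero pr}}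
  ... | suc q | _ = trans (lem x) (trans (cong ((+ 1 / suc q) ℚ.*_) eq) (sym (lem y)))
    where
    lem : ∀ z → z ≡ (+ 1 / suc q) ℚ.* (suc q /1 ℚ.* z)
    lem z = trans (sym (ℚ.*-identityˡ z)) (trans (cong (ℚ._* z) (sym (/1-inverse q)))
      (solve 3 (λ a b z → (a :* b) :* z := b :* (a :* z)) refl (suc q /1) (+ 1 / suc q) z))

  ∣ᵖ-cancel : ∀ m {n x} → p ^ m ℕ.+ n ∣ᵖ (p ℕ.^ m) /1 ℚ.* x → p ^ n ∣ᵖ x
  ∣ᵖ-cancel m {n} {x} (multiple a i eq) = multiple a i $ *-cancelˡ-^ m (trans eq
    (trans (cong (ℚ._* a) (trans (cong _/1 (ℕ.^-distribˡ-+-* p m n)) (/1-* (p ℕ.^ m) (p ℕ.^ n))))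
      (ℚ.*-assoc ((p ℕ.^ m) /1) ((p ℕ.^ n) /1) a)))

  ∣⇒∣ᵖ : ∀ {c} → p ∣ c → p ^ 1 ∣ᵖ c /1
  ∣⇒∣ᵖ {c} (divides q refl) = multiple (q /1) (integral-/1 q pr) $
    trans (cong _/1 (trans (ℕ.*-comm q p) (cong (ℕ._* q) (sym (ℕ.*-identityʳ p))))) (/1-* (p ℕ.^ 1) q)

  -- A positive integer below p is a p-adic unit: its reciprocal is integral.
  ∣ᵖ-cancel-< : ∀ {n} c {x} → suc c < p → p ^ n ∣ᵖ suc c /1 ℚ.* x → p ^ n ∣ᵖ x
  ∣ᵖ-cancel-< {n} c {x} c<p d = subst (p ^ n ∣ᵖ_)
    (trans (solve 3 (λ a b z → b :* (a :* z) := (a :* b) :* z) refl (suc c /1) (+ 1 / suc c) x)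
      (trans (cong (ℚ._* x) (/1-inverse c)) (ℚ.*-identityˡ x)))
    (∣ᵖ-*ˡ (+ 1 / suc c) (integral-fraction (+ 1) (suc c) c<p) d)

  private
    coprime-^ : ∀ {d} → ¬ (p ∣ d) → ∀ n {m} → p ℕ.^ n ∣ m ℕ.* d → p ℕ.^ n ∣ m
    coprime-^ {d} p∤d n {m} pn∣ = coprime-divisor (coprime n) (subst (p ℕ.^ n ∣_) (ℕ.*-comm m d) pn∣)
      where
      coprime₁ : Coprime p d
      coprime₁ {i} (i∣p , i∣d) with prime⇒irreducible pr i∣p
      ... | inj₁ i≡1 = i≡1
      ... | inj₂ refl = contradiction i∣d p∤d
      coprime : ∀ n → Coprime (p ℕ.^ n) d
      coprime zero    (i∣1 , _) = ∣1⇒≡1 i∣1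
      coprime (suc n) {i} (i∣ , i∣d) = coprime n
        ( coprime-divisor (λ {j} (j∣i , j∣p) → coprime₁ (j∣p , ∣-trans j∣i i∣d)) i∣ , i∣d)

  -- Clearing denominators in x = p^n y shows that p^n divides ↥ x times ↧ y, and p^n is coprime to
  -- ↧ y because p does not divide it.
  ∣ᵖ⇒∣↥ : ∀ {n x} → p ^ n ∣ᵖ x → p ℕ.^ n ∣ ∣ ↥ x ∣
  ∣ᵖ⇒∣↥ {n} {x@record{}} (multiple y@record{} i x≡) = coprime-^ (i ∘ subst (p ∣_) (ℕ.*-identityˡ (↧ₙ y))) n num
    where
    q = p ℕ.^ n
    eq : ↥ x ℤ.* (+ (1 ℕ.* ↧ₙ y)) ≡ (+ q ℤ.* ↥ y) ℤ.* ↧ x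
    eq = ℚᵘ.drop-*≡* (ℚᵘ.≃-trans (ℚᵘ.≃-reflexive (cong ℚ.toℚᵘ x≡))
      (ℚᵘ.≃-trans (ℚ.toℚᵘ-homo-* (q /1) y) (ℚᵘ.*-congʳ (toℚᵘ-/1 q))))
    num : q ∣ ∣ ↥ x ∣ ℕ.* (1 ℕ.* ↧ₙ y)
    num = subst (q ∣_) (trans (cong ∣_∣ (sym eq)) (ℤ.abs-* (↥ x) (+ (1 ℕ.* ↧ₙ y))))
      (subst (q ∣_) (sym (trans (cong ∣_∣ (ℤ.*-assoc (+ q) (↥ y) (↧ x))) (ℤ.abs-* (+ q) _))) (m∣m*n _))

  ∣↥⇒∣ᵖ : ∀ {n x} → Integral p x → p ℕ.^ n ∣ ∣ ↥ x ∣ → p ^ n ∣ᵖ x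
  ∣↥⇒∣ᵖ {n} {x@record{}} i q∣ with Signed.∣ᵤ⇒∣ {+ (p ℕ.^ n)} {↥ x} q∣
  ... | Signed.divides k eq = multiple y y-int x≡
    where
    q = p ℕ.^ n
    y = k / ↧ₙ x
    y-int : Integral p y
    y-int p∣ = i (∣-trans p∣ (abs-∣ (↧ y) _ (ℚ.↧-/ k (↧ₙ x))))
    x≡ : x ≡ q /1 ℚ.* y
    x≡ = ℚ.toℚᵘ-injective (ℚᵘ.≃-sym (ℚᵘ.≃-trans (ℚ.toℚᵘ-homo-* (q /1) y)
      (ℚᵘ.≃-trans (ℚᵘ.*-cong (toℚᵘ-/1 q) (ℚ.toℚᵘ-fromℚᵘ (k ℚᵘ./ ↧ₙ x)))
        (ℚᵘ.*≡* (trans (cong (ℤ._* ↧ x) (trans (ℤ.*-comm (+ q) k) (sym eq))) (cong (λ z → ↥ x ℤ.* (+ z)) (sym (ℕ.*-identityˡ (↧ₙ x)))))))))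

  ∣ᵖ⇒mod : ∀ {n x} → p ^ n ∣ᵖ x → x ≡ 0ℚ mod p ^ n
  ∣ᵖ⇒mod {n} {x} d = subst (λ z → Integral p z × p ℕ.^ n ∣ ∣ ↥ z ∣) (sym (ℚ.+-identityʳ x)) (∣ᵖ⇒integral d , ∣ᵖ⇒∣↥ d)

  mod⇒∣ᵖ : ∀ {n x} → x ≡ 0ℚ mod p ^ n → p ^ n ∣ᵖ x
  mod⇒∣ᵖ {n} {x} (i , d) = subst (p ^ n ∣ᵖ_) (ℚ.+-identityʳ x) (∣↥⇒∣ᵖ i d)

-- Finite sums and elementary symmetric functions

∑ : ℕ → (ℕ → ℚ) → ℚ
∑ zero    f = 0ℚ
∑ (suc n) f = f 0 ℚ.+ ∑ n (f ∘ suc)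

∑-cong : ∀ n {f g} → (∀ i → i < n → f i ≡ g i) → ∑ n f ≡ ∑ n g
∑-cong zero    eq = refl
∑-cong (suc n) eq = cong₂ ℚ._+_ (eq 0 (s≤s z≤n)) (∑-cong n λ i i<n → eq (suc i) (s≤s i<n))

∑-zero : ∀ n {f} → (∀ i → i < n → f i ≡ 0ℚ) → ∑ n f ≡ 0ℚ
∑-zero zero    eq = refl
∑-zero (suc n) eq = trans (cong₂ ℚ._+_ (eq 0 (s≤s z≤n)) (∑-zero n λ i i<n → eq (suc i) (s≤s i<n))) (ℚ.+-identityˡ 0ℚ)

∑-*ˡ : ∀ n a f → ∑ n (λ i → a ℚ.* f i) ≡ a ℚ.* ∑ n f
∑-*ˡ zero    a f = sym (ℚ.*-zeroʳ a)
∑-*ˡ (suc n) a f = trans (cong (a ℚ.* f 0 ℚ.+_) (∑-*ˡ n a (f ∘ suc))) (sym (ℚ.*-distribˡ-+ a (f 0) _))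

∑-+ : ∀ n f g → ∑ n (λ i → f i ℚ.+ g i) ≡ ∑ n f ℚ.+ ∑ n g
∑-+ zero    f g = sym (ℚ.+-identityˡ 0ℚ)
∑-+ (suc n) f g = trans (cong (f 0 ℚ.+ g 0 ℚ.+_) (∑-+ n (f ∘ suc) (g ∘ suc)))
  (solve 4 (λ a b c d → (a :+ b) :+ (c :+ d) := (a :+ c) :+ (b :+ d)) refl (f 0) (g 0) (∑ n (f ∘ suc)) (∑ n (g ∘ suc)))

∑-split : ∀ m n f → ∑ (m ℕ.+ n) f ≡ ∑ m f ℚ.+ ∑ n (λ i → f (m ℕ.+ i))
∑-split zero    n f = sym (ℚ.+-identityˡ _)
∑-split (suc m) n f = trans (cong (f 0 ℚ.+_) (∑-split m n (f ∘ suc))) (sym (ℚ.+-assoc (f 0) _ _))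

∑-last : ∀ n f → ∑ (suc n) f ≡ ∑ n f ℚ.+ f n
∑-last zero    f = ℚ.+-comm (f 0) 0ℚ
∑-last (suc n) f = trans (cong (f 0 ℚ.+_) (∑-last n (f ∘ suc))) (sym (ℚ.+-assoc (f 0) _ _))

∑-reverse : ∀ n f → ∑ n f ≡ ∑ n (λ i → f (n ∸ suc i))
∑-reverse zero    f = refl
∑-reverse (suc n) f = trans (∑-last n f) (trans (ℚ.+-comm _ (f n)) (cong (f n ℚ.+_) (∑-reverse n f)))

∣ᵖ-∑ : ∀ {p} (pr : Prime p) {k} n {f} → (∀ i → i < n → p ^ k ∣ᵖ f i) → p ^ k ∣ᵖ ∑ n f
∣ᵖ-∑ pr zero    d = ∣ᵖ-0 pr _
∣ᵖ-∑ pr (suc n) d = ∣ᵖ-+ pr (d 0 (s≤s z≤n)) (∣ᵖ-∑ pr n λ i i<n → d (suc i) (s≤s i<n))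

esym-↭ : ∀ k {xs ys} → xs ↭ ys → esym k xs ≡ esym k ys
esym-↭ zero    p = refl
esym-↭ (suc k) Perm.refl = refl
esym-↭ (suc k) (Perm.prep x p) = cong₂ (λ a b → x ℚ.* a ℚ.+ b) (esym-↭ k p) (esym-↭ (suc k) p)
esym-↭ (suc zero) {_ ∷ _ ∷ xs} {_ ∷ _ ∷ ys} (Perm.swap x y p) = trans
  (cong (λ b → x ℚ.* 1ℚ ℚ.+ (y ℚ.* 1ℚ ℚ.+ b)) (esym-↭ 1 p))
  (solve 3 (λ x y b → x :+ (y :+ b) := y :+ (x :+ b)) refl (x ℚ.* 1ℚ) (y ℚ.* 1ℚ) (esym 1 ys))
esym-↭ (suc (suc k)) {_ ∷ _ ∷ xs} {_ ∷ _ ∷ ys} (Perm.swap x y p)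
  rewrite esym-↭ k p | esym-↭ (suc k) p | esym-↭ (suc (suc k)) p =
  solve 5 (λ x y a b c → x :* (y :* a :+ b) :+ (y :* b :+ c) := y :* (x :* a :+ b) :+ (x :* b :+ c)) refl
    x y (esym k ys) (esym (suc k) ys) (esym (suc (suc k)) ys)
esym-↭ (suc k) (Perm.trans p q) = trans (esym-↭ (suc k) p) (esym-↭ (suc k) q)

esym-scale : ∀ q k xs → esym k (map (q /1 ℚ.*_) xs) ≡ (q ℕ.^ k) /1 ℚ.* esym k xs
esym-scale q zero    xs = refl
esym-scale q (suc k) [] = sym (ℚ.*-zeroʳ ((q ℕ.^ suc k) /1))
esym-scale q (suc k) (x ∷ xs) rewrite esym-scale q k xs | esym-scale q (suc k) xs | /1-* q (q ℕ.^ k) =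
  solve 5 (λ q x r a b → (q :* x) :* (r :* a) :+ (q :* r) :* b := (q :* r) :* (x :* a :+ b)) refl
    (q /1) x ((q ℕ.^ k) /1) (esym k xs) (esym (suc k) xs)

-- umbral xs c = Σ_k c_k e_k(xs), the image of Π_{x ∈ xs} (1 + x t) under the
-- linear map with t^k ↦ c_k.
umbral : List ℚ → (ℕ → ℚ) → ℚ
umbral []       c = c 0
umbral (x ∷ xs) c = umbral xs c ℚ.+ x ℚ.* umbral xs (c ∘ suc)

umbral-cong : ∀ xs {c d} → (∀ k → c k ≡ d k) → umbral xs c ≡ umbral xs d
umbral-cong []       eq = eq 0
umbral-cong (x ∷ xs) eq = cong₂ (λ a b → a ℚ.+ x ℚ.* b) (umbral-cong xs eq) (umbral-cong xs (eq ∘ suc))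

umbral-+ : ∀ xs c d → umbral xs (λ k → c k ℚ.+ d k) ≡ umbral xs c ℚ.+ umbral xs d
umbral-+ []       c d = refl
umbral-+ (x ∷ xs) c d rewrite umbral-+ xs c d | umbral-+ xs (c ∘ suc) (d ∘ suc) =
  solve 5 (λ x a b c d → (a :+ b) :+ x :* (c :+ d) := (a :+ x :* c) :+ (b :+ x :* d)) refl
    x (umbral xs c) (umbral xs d) (umbral xs (c ∘ suc)) (umbral xs (d ∘ suc))

umbral-neg : ∀ xs c → umbral xs (λ k → ℚ.- c k) ≡ ℚ.- umbral xs c
umbral-neg []       c = refl
umbral-neg (x ∷ xs) c rewrite umbral-neg xs c | umbral-neg xs (c ∘ suc) =
  solve 3 (λ x a b → :- a :+ x :* (:- b) := :- (a :+ x :* b)) refl x (umbral xs c) (umbral xs (c ∘ suc))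

-- Any range beyond the number of points will do, since e_k vanishes there; this freedom is what
-- allows a comparison with the truncations of β_k.
umbral-∑ : ∀ xs c n → length xs < n → umbral xs c ≡ ∑ n (λ k → c k ℚ.* esym k xs)
umbral-∑ []       c (suc n) _ = sym (trans
  (cong₂ ℚ._+_ (ℚ.*-identityʳ (c 0)) (∑-zero n λ i _ → ℚ.*-zeroʳ (c (suc i)))) (ℚ.+-identityʳ (c 0)))
umbral-∑ (x ∷ xs) c (suc n) (s≤s l<n)
  rewrite umbral-∑ xs c (suc n) (ℕ.m<n⇒m<1+n l<n) | umbral-∑ xs (c ∘ suc) n l<n = sym (begin
    c 0 ℚ.* 1ℚ ℚ.+ ∑ n (λ k → c (suc k) ℚ.* (x ℚ.* esym k xs ℚ.+ esym (suc k) xs))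
      ≡⟨ cong (c 0 ℚ.* 1ℚ ℚ.+_) (trans (∑-cong n λ k _ →
           solve 4 (λ c x a b → c :* (x :* a :+ b) := x :* (c :* a) :+ c :* b) refl (c (suc k)) x (esym k xs) (esym (suc k) xs))
         (trans (∑-+ n (λ k → x ℚ.* A k) (λ k → Bt k)) (cong (ℚ._+ ∑ n Bt) (∑-*ˡ n x A)))) ⟩
    c 0 ℚ.* 1ℚ ℚ.+ (x ℚ.* ∑ n A ℚ.+ ∑ n Bt)
      ≡⟨ solve 3 (λ a b c → a :+ (b :+ c) := (a :+ c) :+ b) refl (c 0 ℚ.* 1ℚ) (x ℚ.* ∑ n A) (∑ n Bt) ⟩
    (c 0 ℚ.* 1ℚ ℚ.+ ∑ n Bt) ℚ.+ x ℚ.* ∑ n A ∎)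
  where
  open ≡-Reasoning
  A Bt : ℕ → ℚ
  A k = c (suc k) ℚ.* esym k xs
  Bt k = c (suc k) ℚ.* esym (suc k) xs

umbral-↭ : ∀ {xs ys} c → xs ↭ ys → umbral xs c ≡ umbral ys c
umbral-↭ c Perm.refl = refl
umbral-↭ c (Perm.prep x p) = cong₂ (λ a b → a ℚ.+ x ℚ.* b) (umbral-↭ c p) (umbral-↭ (c ∘ suc) p)
umbral-↭ c (Perm.swap {xs} {ys} x y p)
  rewrite umbral-↭ c p | umbral-↭ (c ∘ suc) p | umbral-↭ (c ∘ suc ∘ suc) p =
  solve 5 (λ x y a b c → (a :+ y :* b) :+ x :* (b :+ y :* c) := (a :+ x :* b) :+ y :* (b :+ x :* c)) refl
    x y (umbral ys c) (umbral ys (c ∘ suc)) (umbral ys (c ∘ suc ∘ suc))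
umbral-↭ c (Perm.trans p q) = trans (umbral-↭ c p) (umbral-↭ c q)

-- The shift equation for the product of the 1 + t/i

recips : ℕ → List ℚ
recips n = map (λ i → + 1 / suc i) (upTo n)

length-recips : ∀ n → length (recips n) ≡ n
length-recips n = trans (List.length-map _ (upTo n)) (List.length-upTo n)

recips-suc : ∀ n → recips (suc n) ↭ (+ 1 / suc n) ∷ recips n
recips-suc n = ↭-trans (↭-reflexive (trans (cong (map _) (sym (List.upTo-∷ʳ n))) (List.map-++ _ (upTo n) (n ∷ []))))
  (↭-sym (Perm.∷↭∷ʳ (+ 1 / suc n) (recips n)))

esymPred : ℕ → List ℚ → ℚ
esymPred zero    xs = 0ℚ
esymPred (suc k) xs = esym k xs

esym-∷ : ∀ k x xs → esym k (x ∷ xs) ≡ x ℚ.* esymPred k xs ℚ.+ esym k xs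
esym-∷ zero    x xs = sym (trans (cong (ℚ._+ 1ℚ) (ℚ.*-zeroʳ x)) (ℚ.+-identityˡ 1ℚ))
esym-∷ (suc k) x xs = refl

-- Coefficients of t^m in (t + 1) F(t + 1) = (t + n + 1) F(t), where
-- F(t) = Π_{1≤i≤n} (1 + t/i).
shift-recips : ∀ n m → umbral (recips n) (λ k → (suc k C m) /1) ≡
               esymPred m (recips n) ℚ.+ suc n /1 ℚ.* esym m (recips n)
shift-recips zero zero          = refl
shift-recips zero (suc zero)    = refl
shift-recips zero (suc (suc m)) = cong _/1 (k>n⇒nCk≡0 {1} {suc (suc m)} (s≤s (s≤s z≤n)))
shift-recips (suc n) zero = begin
  umbral (recips (suc n)) _      ≡⟨ umbral-↭ _ (recips-suc n) ⟩
  U ℚ.+ r ℚ.* U                  ≡⟨ cong (λ u → u ℚ.+ r ℚ.* u) (shift-recips n 0) ⟩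
  (0ℚ ℚ.+ a ℚ.* 1ℚ) ℚ.+ r ℚ.* (0ℚ ℚ.+ a ℚ.* 1ℚ)
    ≡⟨ solve 2 (λ a r → (con 0ℚ :+ a :* con 1ℚ) :+ r :* (con 0ℚ :+ a :* con 1ℚ) := a :* r :+ a) refl a r ⟩
  a ℚ.* r ℚ.+ a                  ≡⟨ cong (ℚ._+ a) (/1-inverse n) ⟩
  1ℚ ℚ.+ a                       ≡⟨ sym (/1-+ 1 (suc n)) ⟩
  suc (suc n) /1                 ≡⟨ solve 1 (λ b → b := con 0ℚ :+ b :* con 1ℚ) refl (suc (suc n) /1) ⟩
  0ℚ ℚ.+ suc (suc n) /1 ℚ.* 1ℚ   ∎
  where
  open ≡-Reasoning
  a = suc n /1
  r = + 1 / suc n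
  U = umbral (recips n) (λ k → (suc k C 0) /1)
-- The new factor is 1 + r (t+1) on the left and 1 + r t on the right. Pascal's rule expresses the
-- multiplication by t+1, and (t+n+1)(1 + r (t+1)) = (t+n+2)(1 + r t) because (n+1) r = 1.
shift-recips (suc n) (suc m) = begin
  umbral (recips (suc n)) (c (suc m))
    ≡⟨ umbral-↭ _ (recips-suc n) ⟩
  umbral xs (c (suc m)) ℚ.+ r ℚ.* umbral xs (c (suc m) ∘ suc)
    ≡⟨ cong (λ u → umbral xs (c (suc m)) ℚ.+ r ℚ.* u) (trans
         (umbral-cong xs λ k → trans (cong _/1 (sym (nCk+nC[k+1]≡[n+1]C[k+1] (suc k) m))) (/1-+ (suc k C m) (suc k C suc m)))
         (umbral-+ xs (c m) (c (suc m)))) ⟩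
  umbral xs (c (suc m)) ℚ.+ r ℚ.* (umbral xs (c m) ℚ.+ umbral xs (c (suc m)))
    ≡⟨ cong₂ (λ u v → u ℚ.+ r ℚ.* (v ℚ.+ u)) (shift-recips n (suc m)) (shift-recips n m) ⟩
  (s′ ℚ.+ a ℚ.* s) ℚ.+ r ℚ.* ((s″ ℚ.+ a ℚ.* s′) ℚ.+ (s′ ℚ.+ a ℚ.* s))
    ≡⟨ solve 5 (λ a r s s′ s″ → (s′ :+ a :* s) :+ r :* ((s″ :+ a :* s′) :+ (s′ :+ a :* s)) :=
         (s′ :+ a :* s :+ r :* s″ :+ a :* (r :* s′) :+ r :* s′) :+ (a :* r) :* s) refl a r s s′ s″ ⟩
  (s′ ℚ.+ a ℚ.* s ℚ.+ r ℚ.* s″ ℚ.+ a ℚ.* (r ℚ.* s′) ℚ.+ r ℚ.* s′) ℚ.+ (a ℚ.* r) ℚ.* s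
    ≡⟨ cong (λ z → (s′ ℚ.+ a ℚ.* s ℚ.+ r ℚ.* s″ ℚ.+ a ℚ.* (r ℚ.* s′) ℚ.+ r ℚ.* s′) ℚ.+ z ℚ.* s) (/1-inverse n) ⟩
  (s′ ℚ.+ a ℚ.* s ℚ.+ r ℚ.* s″ ℚ.+ a ℚ.* (r ℚ.* s′) ℚ.+ r ℚ.* s′) ℚ.+ 1ℚ ℚ.* s
    ≡⟨ solve 5 (λ a r s s′ s″ → (s′ :+ a :* s :+ r :* s″ :+ a :* (r :* s′) :+ r :* s′) :+ con 1ℚ :* s :=
         (r :* s″ :+ s′) :+ (con 1ℚ :+ a) :* (r :* s′ :+ s)) refl a r s s′ s″ ⟩
  (r ℚ.* s″ ℚ.+ s′) ℚ.+ (1ℚ ℚ.+ a) ℚ.* (r ℚ.* s′ ℚ.+ s)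
    ≡⟨ cong₂ (λ u v → u ℚ.+ v ℚ.* (r ℚ.* s′ ℚ.+ s))
         (trans (sym (esym-∷ m r xs)) (sym (esym-↭ m (recips-suc n)))) (sym (/1-+ 1 (suc n))) ⟩
  esym m (recips (suc n)) ℚ.+ suc (suc n) /1 ℚ.* (r ℚ.* s′ ℚ.+ s)
    ≡⟨ cong (λ u → esym m (recips (suc n)) ℚ.+ suc (suc n) /1 ℚ.* u) (sym (esym-↭ (suc m) (recips-suc n))) ⟩
  esym m (recips (suc n)) ℚ.+ suc (suc n) /1 ℚ.* esym (suc m) (recips (suc n)) ∎
  where
  open ≡-Reasoning
  xs = recips n
  a = suc n /1
  r = + 1 / suc n
  s = esym (suc m) xs
  s′ = esym m xs
  s″ = esymPred m xs
  c : ℕ → ℕ → ℚ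
  c m k = (suc k C m) /1

-- The involution x ↦ x/(x-1) of the points

*-cancelʳ-≢0 : ∀ x {y} → y ≢ 0ℚ → x ℚ.* y ≡ 0ℚ → x ≡ 0ℚ
*-cancelʳ-≢0 x {y} y≢0 eq = begin
  x                     ≡⟨ sym (ℚ.*-identityʳ x) ⟩
  x ℚ.* 1ℚ              ≡⟨ cong (x ℚ.*_) (sym (ℚ.*-inverseʳ y)) ⟩
  x ℚ.* (y ℚ.* ℚ.1/ y)  ≡⟨ sym (ℚ.*-assoc x y (ℚ.1/ y)) ⟩
  x ℚ.* y ℚ.* ℚ.1/ y    ≡⟨ cong (ℚ._* ℚ.1/ y) eq ⟩
  0ℚ ℚ.* ℚ.1/ y         ≡⟨ ℚ.*-zeroˡ (ℚ.1/ y) ⟩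
  0ℚ                    ∎
  where
  open ≡-Reasoning
  instance _ = ℚ.≢-nonZero y≢0

∏1- : List ℚ → ℚ
∏1- []       = 1ℚ
∏1- (x ∷ xs) = (1ℚ ℚ.- x) ℚ.* ∏1- xs

signedBinomial : ℕ → ℕ → ℚ
signedBinomial k j = (-1^ j) ℚ.* (j C k) /1

-- With y = x / (x - 1): Π (1 - x (1 + t)) = Π (1 - x) · Π (1 + y t).
umbral-mirror : ∀ {I : Set} (f g : I → ℚ) {is} → All (λ i → (1ℚ ℚ.- f i) ℚ.* g i ≡ ℚ.- f i) is →
                ∀ k → umbral (map f is) (signedBinomial k) ≡ ∏1- (map f is) ℚ.* esym k (map g is)
umbral-mirror f g [] zero    = refl
umbral-mirror f g [] (suc k) = refl
umbral-mirror f g {i ∷ is} (eq ∷ eqs) zero = begin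
  U ℚ.+ x ℚ.* umbral (map f is) (signedBinomial 0 ∘ suc)
    ≡⟨ cong (λ u → U ℚ.+ x ℚ.* u) (trans (umbral-cong (map f is) λ j →
         solve 2 (λ s b → (:- s) :* b := :- (s :* b)) refl (-1^ j) (1 /1)) (umbral-neg (map f is) (signedBinomial 0))) ⟩
  U ℚ.+ x ℚ.* (ℚ.- U)
    ≡⟨ cong (λ u → u ℚ.+ x ℚ.* (ℚ.- u)) (umbral-mirror f g eqs 0) ⟩
  P ℚ.* 1ℚ ℚ.+ x ℚ.* (ℚ.- (P ℚ.* 1ℚ))
    ≡⟨ solve 2 (λ x P → P :* con 1ℚ :+ x :* (:- (P :* con 1ℚ)) := ((con 1ℚ :- x) :* P) :* con 1ℚ) refl x P ⟩
  (1ℚ ℚ.- x) ℚ.* P ℚ.* 1ℚ ∎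
  where
  open ≡-Reasoning
  x = f i
  U = umbral (map f is) (signedBinomial 0)
  P = ∏1- (map f is)
umbral-mirror f g {i ∷ is} (eq ∷ eqs) (suc k) = begin
  U ℚ.+ x ℚ.* umbral xs (signedBinomial (suc k) ∘ suc)
    ≡⟨ cong (λ u → U ℚ.+ x ℚ.* u) (trans (umbral-cong xs pascal) (trans
         (umbral-neg xs (λ j → signedBinomial k j ℚ.+ signedBinomial (suc k) j))
         (cong ℚ.-_ (umbral-+ xs (signedBinomial k) (signedBinomial (suc k)))))) ⟩
  U ℚ.+ x ℚ.* (ℚ.- (umbral xs (signedBinomial k) ℚ.+ U))
    ≡⟨ cong₂ (λ u v → u ℚ.+ x ℚ.* (ℚ.- (v ℚ.+ u))) (umbral-mirror f g eqs (suc k)) (umbral-mirror f g eqs k) ⟩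
  P ℚ.* b ℚ.+ x ℚ.* (ℚ.- (P ℚ.* a ℚ.+ P ℚ.* b))
    ≡⟨ solve 4 (λ x P a b → P :* b :+ x :* (:- (P :* a :+ P :* b)) := P :* ((:- x) :* a) :+ ((con 1ℚ :- x) :* P) :* b) refl x P a b ⟩
  P ℚ.* ((ℚ.- x) ℚ.* a) ℚ.+ (1ℚ ℚ.- x) ℚ.* P ℚ.* b
    ≡⟨ cong (λ z → P ℚ.* (z ℚ.* a) ℚ.+ (1ℚ ℚ.- x) ℚ.* P ℚ.* b) (sym eq) ⟩
  P ℚ.* ((1ℚ ℚ.- x) ℚ.* y ℚ.* a) ℚ.+ (1ℚ ℚ.- x) ℚ.* P ℚ.* b
    ≡⟨ solve 5 (λ x y P a b → P :* ((con 1ℚ :- x) :* y :* a) :+ (con 1ℚ :- x) :* P :* b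
                  := (con 1ℚ :- x) :* P :* (y :* a :+ b)) refl x y P a b ⟩
  (1ℚ ℚ.- x) ℚ.* P ℚ.* (y ℚ.* a ℚ.+ b) ∎
  where
  open ≡-Reasoning
  xs = map f is
  x = f i
  y = g i
  U = umbral xs (signedBinomial (suc k))
  P = ∏1- xs
  a = esym k (map g is)
  b = esym (suc k) (map g is)
  pascal : ∀ j → signedBinomial (suc k) (suc j) ≡ ℚ.- (signedBinomial k j ℚ.+ signedBinomial (suc k) j)
  pascal j = trans
    (cong ((ℚ.- (-1^ j)) ℚ.*_) (trans (cong _/1 (sym (nCk+nC[k+1]≡[n+1]C[k+1] j k))) (/1-+ (j C k) (j C suc k))))
    (solve 3 (λ s a b → (:- s) :* (a :+ b) := :- (s :* a :+ s :* b)) refl (-1^ j) ((j C k) /1) ((j C suc k) /1))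

-- The involution inverts 1 - x: with (1 - x) y = -x one has (1 - x)(1 - y) = 1 - x - (1 - x) y = 1.
∏1--mirror : ∀ {I : Set} (f g : I → ℚ) {is} → All (λ i → (1ℚ ℚ.- f i) ℚ.* g i ≡ ℚ.- f i) is →
             ∏1- (map f is) ℚ.* ∏1- (map g is) ≡ 1ℚ
∏1--mirror f g [] = refl
∏1--mirror f g {i ∷ is} (eq ∷ eqs) = begin
  (1ℚ ℚ.- x) ℚ.* P ℚ.* ((1ℚ ℚ.- y) ℚ.* Q)
    ≡⟨ solve 4 (λ x y P Q → (con 1ℚ :- x) :* P :* ((con 1ℚ :- y) :* Q)
                  := (con 1ℚ :- x :- (con 1ℚ :- x) :* y) :* (P :* Q)) refl x y P Q ⟩
  (1ℚ ℚ.- x ℚ.- (1ℚ ℚ.- x) ℚ.* y) ℚ.* (P ℚ.* Q)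
    ≡⟨ cong₂ (λ u v → (1ℚ ℚ.- x ℚ.- u) ℚ.* v) eq (∏1--mirror f g eqs) ⟩
  (1ℚ ℚ.- x ℚ.- ℚ.- x) ℚ.* 1ℚ
    ≡⟨ solve 1 (λ x → (con 1ℚ :- x :- (:- x)) :* con 1ℚ := con 1ℚ) refl x ⟩
  1ℚ ∎
  where
  open ≡-Reasoning
  x = f i
  y = g i
  P = ∏1- (map f is)
  Q = ∏1- (map g is)

∏1--↭ : ∀ {xs ys} → xs ↭ ys → ∏1- xs ≡ ∏1- ys
∏1--↭ Perm.refl = refl
∏1--↭ (Perm.prep x p) = cong ((1ℚ ℚ.- x) ℚ.*_) (∏1--↭ p)
∏1--↭ (Perm.swap {xs} {ys} x y p) rewrite ∏1--↭ p =
  solve 3 (λ a b c → a :* (b :* c) := b :* (a :* c)) refl (1ℚ ℚ.- x) (1ℚ ℚ.- y) (∏1- ys)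
∏1--↭ (Perm.trans p q) = trans (∏1--↭ p) (∏1--↭ q)

∏1-≡1 : ∀ {p} (pr : Prime p) {xs} → All (p ^ 1 ∣ᵖ_) xs → p ^ 1 ∣ᵖ ∏1- xs ℚ.- 1ℚ
∏1-≡1 pr [] = ∣ᵖ-0 pr 1
∏1-≡1 {p} pr {x ∷ xs} (d ∷ ds) = subst (p ^ 1 ∣ᵖ_)
  (solve 2 (λ x P → (con 1ℚ :- x) :* (P :- con 1ℚ) :- x := (con 1ℚ :- x) :* P :- con 1ℚ) refl x (∏1- xs))
  (∣ᵖ-minus pr (∣ᵖ-*ˡ pr (1ℚ ℚ.- x) (integral-+ 1ℚ (ℚ.- x) pr (∤1 pr) (integral-neg x (∣ᵖ⇒integral pr d))) (∏1-≡1 pr ds)) d)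

reflect-upTo : ∀ n → map (λ i → n ∸ suc i) (upTo n) ↭ upTo n
reflect-upTo n = ↭-trans (↭-reflexive (trans (List.map-upTo _ n) (trans (reflect n) (sym (List.reverse-upTo n)))))
  (Perm.↭-reverse (upTo n))
  where
  reflect : ∀ n → applyUpTo (λ i → n ∸ suc i) n ≡ downFrom n
  reflect zero    = refl
  reflect (suc n) = cong (n ∷_) (reflect n)

point : ℕ → ℕ → ℚ
point p i = + p / suc i

mirror-points : ∀ n → map (λ i → point (suc n) (n ∸ suc i)) (upTo n) ↭ points (suc n)
mirror-points n = ↭-trans (↭-reflexive (List.map-∘ (upTo n))) (Perm.map⁺ (point (suc n)) (reflect-upTo n))

-- The partner of x = p/j is x/(x-1) = p/(p-j). The equation avoids the division, and the index i
-- stands for j = i + 1, so that p - j has index n ∸ suc i.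
point-mirror : ∀ n → All (λ i → (1ℚ ℚ.- point (suc n) i) ℚ.* point (suc n) (n ∸ suc i) ≡ ℚ.- point (suc n) i) (upTo n)
point-mirror n = All.tabulate λ {i} i∈ → lemma i (∈-upTo⁻ i∈)
  where
  lemma : ∀ i → i < n → (1ℚ ℚ.- point (suc n) i) ℚ.* point (suc n) (n ∸ suc i) ≡ ℚ.- point (suc n) i
  lemma i i<n = begin
    (1ℚ ℚ.- point (suc n) i) ℚ.* point (suc n) d
      ≡⟨ cong₂ (λ x y → (1ℚ ℚ.- x) ℚ.* y) (as-sum i) (as-sum d) ⟩
    (1ℚ ℚ.- (u ℚ.+ v) ℚ.* a) ℚ.* ((u ℚ.+ v) ℚ.* b)
      ≡⟨ solve 4 (λ u v a b → (con 1ℚ :- (u :+ v) :* a) :* ((u :+ v) :* b)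
           := (con 1ℚ :- u :* a :- v :* a) :* (u :* b :+ v :* b)) refl u v a b ⟩
    (1ℚ ℚ.- u ℚ.* a ℚ.- v ℚ.* a) ℚ.* (u ℚ.* b ℚ.+ v ℚ.* b)
      ≡⟨ cong₂ (λ x y → (1ℚ ℚ.- x ℚ.- v ℚ.* a) ℚ.* (u ℚ.* b ℚ.+ y)) (/1-inverse i) (/1-inverse d) ⟩
    (1ℚ ℚ.- 1ℚ ℚ.- v ℚ.* a) ℚ.* (u ℚ.* b ℚ.+ 1ℚ)
      ≡⟨ solve 4 (λ u v a b → (con 1ℚ :- con 1ℚ :- v :* a) :* (u :* b :+ con 1ℚ)
           := :- ((u :* a) :* (v :* b) :+ v :* a)) refl u v a b ⟩
    ℚ.- ((u ℚ.* a) ℚ.* (v ℚ.* b) ℚ.+ v ℚ.* a)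
      ≡⟨ cong (λ x → ℚ.- ((u ℚ.* a) ℚ.* x ℚ.+ v ℚ.* a)) (/1-inverse d) ⟩
    ℚ.- ((u ℚ.* a) ℚ.* 1ℚ ℚ.+ v ℚ.* a)
      ≡⟨ solve 3 (λ u v a → :- ((u :* a) :* con 1ℚ :+ v :* a) := :- ((u :+ v) :* a)) refl u v a ⟩
    ℚ.- ((u ℚ.+ v) ℚ.* a)
      ≡⟨ cong ℚ.-_ (sym (as-sum i)) ⟩
    ℚ.- point (suc n) i ∎
    where
    open ≡-Reasoning
    d = n ∸ suc i
    u = suc i /1
    v = suc d /1
    a = + 1 / suc i
    b = + 1 / suc d
    as-sum : ∀ j → point (suc n) j ≡ (u ℚ.+ v) ℚ.* (+ 1 / suc j)
    as-sum j = trans (/-as-* (suc n) j) (cong (ℚ._* (+ 1 / suc j)) (trans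
      (cong _/1 (sym (trans (ℕ.+-suc (suc i) d) (cong suc (ℕ.m+[n∸m]≡n i<n))))) (/1-+ (suc i) (suc d))))

-- The involution permutes the points, so the product P satisfies P² = 1. All points are multiples
-- of p, hence P ≡ 1 mod p, and P = -1 would make p divide 2.
∏1-points : ∀ {n} → Prime (suc n) → 2 < suc n → ∏1- (points (suc n)) ≡ 1ℚ
∏1-points {n} pr 2<p with ∏1- (points (suc n)) ℚ.+ 1ℚ ℚ.≟ 0ℚ
... | no P≢-1 = begin
  P                  ≡⟨ solve 1 (λ P → P := (P :- con 1ℚ) :+ con 1ℚ) refl P ⟩
  P ℚ.- 1ℚ ℚ.+ 1ℚ    ≡⟨ cong (ℚ._+ 1ℚ) (*-cancelʳ-≢0 (P ℚ.- 1ℚ) P≢-1 product) ⟩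
  0ℚ ℚ.+ 1ℚ          ≡⟨ ℚ.+-identityˡ 1ℚ ⟩
  1ℚ                 ∎
  where
  open ≡-Reasoning
  P = ∏1- (points (suc n))
  product : (P ℚ.- 1ℚ) ℚ.* (P ℚ.+ 1ℚ) ≡ 0ℚ
  product = trans (solve 1 (λ P → (P :- con 1ℚ) :* (P :+ con 1ℚ) := P :* P :- con 1ℚ) refl P)
    (cong (ℚ._- 1ℚ) (trans (cong (P ℚ.*_) (sym (∏1--↭ (mirror-points n)))) (∏1--mirror (point (suc n)) _ (point-mirror n))))
... | yes P≡-1 = contradiction (subst (_∣ 1) (ℕ.*-identityʳ (suc n)) (∣ᵖ⇒∣↥ pr {1} {1ℚ} p∣1)) (∤1 pr)
  where
  P = ∏1- (points (suc n))
  p∣points : All (suc n ^ 1 ∣ᵖ_) (points (suc n))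
  p∣points = All.map⁺ (All.tabulate λ {i} i∈ → multiple (+ 1 / suc i) (integral-fraction (+ 1) (suc i) (s≤s (∈-upTo⁻ i∈)))
    (trans (/-as-* (suc n) i) (cong (λ z → z /1 ℚ.* (+ 1 / suc i)) (sym (ℕ.*-identityʳ (suc n))))))
    where import Data.List.Relation.Unary.All.Properties as All
  p∣1 : suc n ^ 1 ∣ᵖ 1ℚ
  p∣1 = ∣ᵖ-cancel-< pr 1 2<p (subst (suc n ^ 1 ∣ᵖ_)
    (trans (solve 1 (λ P → :- (P :- con 1ℚ) := (con 1ℚ :+ con 1ℚ) :- (P :+ con 1ℚ)) refl P)
      (cong (λ z → (1ℚ ℚ.+ 1ℚ) ℚ.- z) P≡-1))
    (∣ᵖ-neg pr (∏1-≡1 pr p∣points)))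

length-points : ∀ n → length (points (suc n)) ≡ n
length-points n = trans (List.length-map _ (upTo n)) (List.length-upTo n)

-- This is the vanishing of β_k at the points: the factor Π (1 - x) is 1 and the mirrored points are
-- the same points in another order.
esym-points-mirror : ∀ {n} → Prime (suc n) → 2 < suc n → ∀ k →
                     umbral (points (suc n)) (signedBinomial k) ≡ esym k (points (suc n))
esym-points-mirror {n} pr 2<p k = trans (umbral-mirror (point (suc n)) _ (point-mirror n) k)
  (trans (cong₂ ℚ._*_ (∏1-points pr 2<p) (esym-↭ k (mirror-points n))) (ℚ.*-identityˡ _))

points≡scale : ∀ n → points (suc n) ≡ map (suc n /1 ℚ.*_) (recips n)
points≡scale n = trans (List.map-cong (/-as-* (suc n)) (upTo n)) (List.map-∘ (upTo n))

esym-points : ∀ n k → esym k (points (suc n)) ≡ (suc n ℕ.^ k) /1 ℚ.* esym k (recips n)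
esym-points n k = trans (cong (esym k) (points≡scale n)) (esym-scale (suc n) k (recips n))

-- Binomial coefficients modulo a prime

C-factorial : ∀ x y → ((x ℕ.+ y) C x) ℕ.* (x ! ℕ.* y !) ≡ (x ℕ.+ y) !
C-factorial x y = subst (λ z → ((x ℕ.+ y) C x) ℕ.* (x ! ℕ.* z !) ≡ (x ℕ.+ y) !) (ℕ.m+n∸m≡n x y)
  (trans (cong (ℕ._* (x ! ℕ.* (x ℕ.+ y ∸ x) !)) (nCk≡n!/k![n-k]! (ℕ.m≤m+n x y)))
    (m/n*n≡m {{nz}} (k![n∸k]!∣n! (ℕ.m≤m+n x y))))
  where nz = ℕ._!*_!≢0 x (x ℕ.+ y ∸ x)

-- Both sides are the trinomial coefficient (m+a+b)! / (m! a! b!).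
C-trinomial : ∀ m a b → ((m ℕ.+ (a ℕ.+ b)) C (m ℕ.+ a)) ℕ.* ((m ℕ.+ a) C m) ≡ ((m ℕ.+ (a ℕ.+ b)) C m) ℕ.* ((a ℕ.+ b) C a)
C-trinomial m a b = ℕ.*-cancelʳ-≡ _ _ (m ! ℕ.* (a ! ℕ.* b !)) {{ℕ.m*n≢0 (m !) _ {{ℕ._!≢0 m}} {{ℕ._!*_!≢0 a b}}}} (begin
  ((m ℕ.+ (a ℕ.+ b)) C (m ℕ.+ a)) ℕ.* c ℕ.* (m ! ℕ.* (a ! ℕ.* b !))
    ≡⟨ ℕ-solve 5 (λ x c m a b → (x · c) · (m · (a · b)) ≗ x · ((c · (m · a)) · b)) refl ((m ℕ.+ (a ℕ.+ b)) C (m ℕ.+ a)) c (m !) (a !) (b !) ⟩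
  ((m ℕ.+ (a ℕ.+ b)) C (m ℕ.+ a)) ℕ.* ((c ℕ.* (m ! ℕ.* a !)) ℕ.* b !)
    ≡⟨ cong₂ (λ n z → (n C (m ℕ.+ a)) ℕ.* (z ℕ.* b !)) (sym (ℕ.+-assoc m a b)) (C-factorial m a) ⟩
  ((m ℕ.+ a ℕ.+ b) C (m ℕ.+ a)) ℕ.* ((m ℕ.+ a) ! ℕ.* b !)
    ≡⟨ C-factorial (m ℕ.+ a) b ⟩
  (m ℕ.+ a ℕ.+ b) !
    ≡⟨ cong _! (ℕ.+-assoc m a b) ⟩
  (m ℕ.+ (a ℕ.+ b)) !
    ≡⟨ sym (C-factorial m (a ℕ.+ b)) ⟩
  d ℕ.* (m ! ℕ.* (a ℕ.+ b) !)
    ≡⟨ cong (λ z → d ℕ.* (m ! ℕ.* z)) (sym (C-factorial a b)) ⟩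
  d ℕ.* (m ! ℕ.* (((a ℕ.+ b) C a) ℕ.* (a ! ℕ.* b !)))
    ≡⟨ ℕ-solve 4 (λ d m x y → d · (m · (x · y)) ≗ (d · x) · (m · y)) refl d (m !) ((a ℕ.+ b) C a) (a ! ℕ.* b !) ⟩
  d ℕ.* ((a ℕ.+ b) C a) ℕ.* (m ! ℕ.* (a ! ℕ.* b !)) ∎)
  where
  open ≡-Reasoning
  open ℕ.+-*-Solver using () renaming (solve to ℕ-solve; _:*_ to _·_; _:=_ to _≗_)
  c = (m ℕ.+ a) C m
  d = (m ℕ.+ (a ℕ.+ b)) C m

C-absorption : ∀ {n k} → k ≤ n → suc k ℕ.* (suc n C suc k) ≡ suc n ℕ.* (n C k)
C-absorption {n} {k} k≤n = begin
  suc k ℕ.* (suc n C suc k)   ≡⟨ ℕ.*-comm (suc k) (suc n C suc k) ⟩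
  (suc n C suc k) ℕ.* suc k   ≡⟨ cong ((suc n C suc k) ℕ.*_) (sym (nC1≡n (suc k))) ⟩
  (suc n C suc k) ℕ.* (suc k C 1) ≡⟨ subst (λ z → (suc z C suc k) ℕ.* (suc k C 1) ≡ (suc z C 1) ℕ.* (z C k)) (ℕ.m+[n∸m]≡n k≤n)
                                    (C-trinomial 1 k (n ∸ k)) ⟩
  (suc n C 1) ℕ.* (n C k)     ≡⟨ cong (ℕ._* (n C k)) (nC1≡n (suc n)) ⟩
  suc n ℕ.* (n C k)           ∎
  where open ≡-Reasoning

C-pred : ∀ n → suc n C n ≡ suc n
C-pred n = trans (nCk≡nC[n∸k] (ℕ.n≤1+n n)) (trans (cong (suc n C_) (ℕ.m+n∸n≡m 1 n)) (nC1≡n (suc n)))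

prime∣C : ∀ {n k} → Prime (suc n) → k < n → suc n ∣ suc n C suc k
prime∣C {n} {k} pr k<n
  with euclidsLemma (suc k) (suc n C suc k) pr (subst (suc n ∣_) (sym (C-absorption (ℕ.<⇒≤ k<n))) (m∣m*n (n C k)))
... | inj₁ p∣1+k = contradiction (∣⇒≤ p∣1+k) (ℕ.<⇒≱ (s≤s k<n))
... | inj₂ p∣C   = p∣C

-- Neighbouring entries of row p-1 add up to an inner entry of row p, a multiple of p, so the sign
-- alternates.
C-sign : ∀ {n} (pr : Prime (suc n)) k → k ≤ n → suc n ^ 1 ∣ᵖ (n C k) /1 ℚ.- -1^ k
C-sign {n} pr zero    k≤n = ∣ᵖ-0 pr 1
C-sign {n} pr (suc k) k<n = subst (suc n ^ 1 ∣ᵖ_)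
  (trans (cong (λ z → z ℚ.- ((n C k) /1 ℚ.- -1^ k)) (trans (cong _/1 (sym (nCk+nC[k+1]≡[n+1]C[k+1] n k))) (/1-+ (n C k) (n C suc k))))
    (solve 3 (λ a b s → (a :+ b) :- (a :- s) := b :- (:- s)) refl ((n C k) /1) ((n C suc k) /1) (-1^ k)))
  (∣ᵖ-minus pr (∣⇒∣ᵖ pr (prime∣C pr k<n)) (C-sign pr k (ℕ.<⇒≤ k<n)))

-- Bernoulli numbers

B-step : ∀ n → B n ≡ bernoulliStep n (bernoullis n)
B-step n = Vec.last-∷ʳ (bernoulliStep n (bernoullis n)) (bernoullis n)

lookup-∷ʳ : ∀ {n} (xs : Vec ℚ n) x (f : ℕ → ℚ) → (∀ j → lookup xs j ≡ f (toℕ j)) → x ≡ f n →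
            ∀ j → lookup (xs Vec.∷ʳ x) j ≡ f (toℕ j)
lookup-∷ʳ []       x f eqs eq Fin.zero    = eq
lookup-∷ʳ (y ∷ xs) x f eqs eq Fin.zero    = eqs Fin.zero
lookup-∷ʳ (y ∷ xs) x f eqs eq (Fin.suc j) = lookup-∷ʳ xs x (f ∘ suc) (eqs ∘ Fin.suc) eq j

lookup-bernoullis : ∀ n j → lookup (bernoullis n) j ≡ B (toℕ j)
lookup-bernoullis (suc n) = lookup-∷ʳ (bernoullis n) _ B (lookup-bernoullis n) (sym (B-step n))

foldr-tabulate : ∀ n (f : ℕ → ℚ) {g : Fin n → ℚ} → (∀ j → g j ≡ f (toℕ j)) →
                 Vec.foldr′ ℚ._+_ 0ℚ (Vec.tabulate g) ≡ ∑ n f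
foldr-tabulate zero    f eq = refl
foldr-tabulate (suc n) f eq = cong₂ ℚ._+_ (eq Fin.zero) (foldr-tabulate n (f ∘ suc) (eq ∘ Fin.suc))

bernoulli-recurrence : ∀ n → ∑ (2 ℕ.+ n) (λ j → ((2 ℕ.+ n) C j) /1 ℚ.* B j) ≡ 0ℚ
bernoulli-recurrence n = begin
  ∑ (2 ℕ.+ n) f                                ≡⟨ ∑-last (suc n) f ⟩
  S ℚ.+ ((2 ℕ.+ n) C suc n) /1 ℚ.* B (suc n)   ≡⟨ cong₂ (λ c b → S ℚ.+ c /1 ℚ.* b) (C-pred (suc n)) Bn ⟩
  S ℚ.+ a ℚ.* (ℚ.- (r ℚ.* S))                  ≡⟨ solve 3 (λ S a r → S :+ a :* (:- (r :* S)) := S :- (a :* r) :* S) refl S a r ⟩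
  S ℚ.- (a ℚ.* r) ℚ.* S                        ≡⟨ cong (λ z → S ℚ.- z ℚ.* S) (/1-inverse (suc n)) ⟩
  S ℚ.- 1ℚ ℚ.* S                               ≡⟨ solve 1 (λ S → S :- con 1ℚ :* S := con 0ℚ) refl S ⟩
  0ℚ                                           ∎
  where
  open ≡-Reasoning
  f : ℕ → ℚ
  f j = ((2 ℕ.+ n) C j) /1 ℚ.* B j
  S = ∑ (suc n) f
  a = (2 ℕ.+ n) /1
  r = + 1 / (2 ℕ.+ n)
  Bn : B (suc n) ≡ ℚ.- (r ℚ.* S)
  Bn = trans (B-step (suc n)) (cong (λ z → ℚ.- (r ℚ.* z)) (foldr-tabulate (suc n) f
    λ j → cong (((2 ℕ.+ n) C toℕ j) /1 ℚ.*_) (lookup-bernoullis (suc n) j)))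

-- In the recurrence that determines B_n its coefficient is n + 1, a unit below p. The bound stops
-- just short of B_{p-1}.
integral-B : ∀ {p} → Prime p → ∀ n → suc n < p → Integral p (B n)
integral-B {p} pr n n<p = below (suc n) n ℕ.≤-refl n<p
  where
  below : ∀ k n → n < k → suc n < p → Integral p (B n)
  below (suc k) zero    _         _   = ∤1 pr
  below (suc k) (suc n) (s≤s n<k) n<p = ∣ᵖ⇒integral pr {0} (∣ᵖ-cancel-< pr (suc n) n<p
    (subst (λ c → p ^ 0 ∣ᵖ c /1 ℚ.* B (suc n)) (C-pred (suc n))
      (subst (p ^ 0 ∣ᵖ_) isolate (∣ᵖ-neg pr (∣ᵖ-∑ pr (suc n) {f} λ j j≤n → ∣ᵖ-*ˡ pr (((2 ℕ.+ n) C j) /1) (integral-/1 ((2 ℕ.+ n) C j) pr)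
        (integral⇒∣ᵖ pr {B j} (below k j (ℕ.<-≤-trans j≤n n<k) (ℕ.<-trans (s≤s j≤n) n<p))))))))
    where
    f : ℕ → ℚ
    f j = ((2 ℕ.+ n) C j) /1 ℚ.* B j
    isolate : ℚ.- ∑ (suc n) f ≡ f (suc n)
    isolate = trans (solve 2 (λ S x → :- S := x :- (S :+ x)) refl (∑ (suc n) f) (f (suc n)))
      (trans (cong (λ z → f (suc n) ℚ.- z) (trans (sym (∑-last (suc n) f)) (bernoulli-recurrence n))) (ℚ.+-identityʳ (f (suc n))))

-- Elementary symmetric functions of 1, 1/2, …, 1/n, where p = n + 1 is prime

integral-esym-recips : ∀ {n} → Prime (suc n) → ∀ k → Integral (suc n) (esym k (recips n))
integral-esym-recips pr k = integral-esym pr k (All.map⁺ (All.tabulate λ {i} i∈ →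
  integral-fraction (+ 1) (suc i) (s≤s (∈-upTo⁻ i∈))))

-- For F(t) = Σ x_k t^k of degree m + r, this is the coefficient of t^m in (t+1) F(t+1) - t F(t):
-- the term x_{m-1} cancels, and the sum starts at x_m.
shift : (ℕ → ℚ) → ℕ → ℕ → ℚ
shift x m r = ∑ (suc r) (λ i → (suc (m ℕ.+ i) C m) /1 ℚ.* x (m ℕ.+ i))

shift-esym-recips : ∀ m r → shift (λ k → esym k (recips (suc m ℕ.+ r))) (suc m) r
                    ≡ suc (suc m ℕ.+ r) /1 ℚ.* esym (suc m) (recips (suc m ℕ.+ r))
shift-esym-recips m r = begin
  S                                          ≡⟨ solve 2 (λ S a → S := (a :+ S) :- a) refl S (esym m xs) ⟩
  (esym m xs ℚ.+ S) ℚ.- esym m xs            ≡⟨ cong (λ z → z ℚ.+ S ℚ.- esym m xs) (sym low) ⟩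
  (∑ (suc m) f ℚ.+ S) ℚ.- esym m xs          ≡⟨ cong (ℚ._- esym m xs) (sym (∑-split (suc m) (suc r) f)) ⟩
  ∑ (suc m ℕ.+ suc r) f ℚ.- esym m xs        ≡⟨ cong (ℚ._- esym m xs) (sym (umbral-∑ xs _ (suc m ℕ.+ suc r) (ℕ.≤-reflexive
                                                  (trans (cong suc (length-recips n)) (sym (ℕ.+-suc (suc m) r)))))) ⟩
  umbral xs (λ k → (suc k C suc m) /1) ℚ.- esym m xs ≡⟨ cong (ℚ._- esym m xs) (shift-recips n (suc m)) ⟩
  (esym m xs ℚ.+ P) ℚ.- esym m xs            ≡⟨ solve 2 (λ P a → (a :+ P) :- a := P) refl P (esym m xs) ⟩
  P                                          ∎
  where
  open ≡-Reasoning
  n = suc m ℕ.+ r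
  xs = recips n
  P = suc n /1 ℚ.* esym (suc m) xs
  S = shift (λ k → esym k xs) (suc m) r
  f : ℕ → ℚ
  f k = (suc k C suc m) /1 ℚ.* esym k xs
  low : ∑ (suc m) f ≡ esym m xs
  low = trans (∑-last m f) (trans (cong₂ ℚ._+_
    (∑-zero m λ k k<m → trans (cong (λ c → c /1 ℚ.* esym k xs) (k>n⇒nCk≡0 (s≤s k<m))) (ℚ.*-zeroˡ (esym k xs)))
    (trans (cong (λ c → c /1 ℚ.* esym m xs) (nCn≡1 (suc m))) (ℚ.*-identityˡ (esym m xs)))) (ℚ.+-identityˡ _))

module _ {n} (pr : Prime (suc n)) where

  private p = suc n

  -- The coefficient m + 1 of x m in shift x m r is a p-adic unit, so that the
  -- system can be solved downwards from x n.
  shift-triangular : ∀ x e →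
    (∀ m r → suc m ℕ.+ suc r ≡ n → p ^ e ∣ᵖ shift x (suc m) (suc r)) →
    (∀ m r → suc m ℕ.+ suc r ≡ n → p ^ e ∣ᵖ (suc n C suc m) /1 ℚ.* x n) →
    ∀ m r → suc m ℕ.+ suc r ≡ n → p ^ e ∣ᵖ x (suc m)
  shift-triangular x e sums tops m r = below (suc r) m r ℕ.≤-refl
    where
    below : ∀ k m r → r < k → suc m ℕ.+ suc r ≡ n → p ^ e ∣ᵖ x (suc m)
    below (suc k) m r (s≤s r≤k) eq = ∣ᵖ-cancel-< pr (suc m)
      (s≤s (subst (suc (suc m) ≤_) (trans (sym (ℕ.+-suc (suc m) r)) eq) (ℕ.m≤m+n (suc (suc m)) r)))
      (subst (λ c → p ^ e ∣ᵖ c /1 ℚ.* x (suc m)) (C-pred (suc m))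
        (subst (λ j → p ^ e ∣ᵖ (suc j C suc m) /1 ℚ.* x j) (ℕ.+-identityʳ (suc m))
          (subst (p ^ e ∣ᵖ_) (solve 2 (λ a b → (a :+ b) :- b := a) refl (f 0) (∑ (suc r) (f ∘ suc)))
            (∣ᵖ-minus pr (sums m r eq) (∣ᵖ-∑ pr (suc r) rest)))))
      where
      f : ℕ → ℚ
      f i = (suc (suc m ℕ.+ i) C suc m) /1 ℚ.* x (suc m ℕ.+ i)
      rest : ∀ i → i < suc r → p ^ e ∣ᵖ f (suc i)
      rest i (s≤s i≤r) with ℕ.m≤n⇒m<n∨m≡n i≤r
      -- The last term is that of `x n`, the free parameter of the system.
      ... | inj₂ refl = subst (λ j → p ^ e ∣ᵖ (suc j C suc m) /1 ℚ.* x j) (sym eq) (tops m r eq)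
      ... | inj₁ i<r  = ∣ᵖ-*ˡ pr ((suc (suc m ℕ.+ suc i) C suc m) /1) (integral-/1 (suc (suc m ℕ.+ suc i) C suc m) pr)
        (below k (m ℕ.+ suc i) (r ∸ suc i) (ℕ.<-≤-trans (ℕ.∸-monoʳ-< (s≤s z≤n) i<r) r≤k)
          (trans (cong suc (trans (ℕ.+-assoc m (suc i) (suc (r ∸ suc i)))
            (cong (m ℕ.+_) (trans (ℕ.+-suc (suc i) (r ∸ suc i)) (cong suc (ℕ.m+[n∸m]≡n i<r)))))) eq))

  private
    s : ℕ → ℚ
    s k = esym k (recips n)

    u : ℚ
    u = s n

    shift-s : ∀ m r → suc m ℕ.+ r ≡ n → shift s (suc m) r ≡ p /1 ℚ.* s (suc m)
    shift-s m r refl = shift-esym-recips m r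

    p∣p : p ^ 1 ∣ᵖ p /1
    p∣p = subst (λ z → p ^ 1 ∣ᵖ z /1) (ℕ.*-identityʳ p) (^∣ᵖ^ pr 1)

    ≤⇒< : ∀ m r → suc m ℕ.+ suc r ≡ n → m < n
    ≤⇒< m r eq = subst (suc m ≤_) eq (ℕ.m≤m+n (suc m) (suc r))

  -- The right-hand sides are p s_{m+1}, and the top entry s_{p-1} enters with the coefficient C(p,
  -- m+1); both are multiples of p. The equation with `r` encodes m + 1 ≤ p - 2.
  p∣esym-recips : ∀ m r → suc m ℕ.+ suc r ≡ n → p ^ 1 ∣ᵖ esym (suc m) (recips n)
  p∣esym-recips = shift-triangular s 1
    (λ m r eq → subst (p ^ 1 ∣ᵖ_) (sym (shift-s m (suc r) eq)) (∣ᵖ-*ʳ pr (s (suc m)) p∣p (integral-esym-recips pr (suc m))))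
    (λ m r eq → ∣ᵖ-*ʳ pr u (∣⇒∣ᵖ pr (prime∣C pr (≤⇒< m r eq))) (integral-esym-recips pr n))

  -- u = 1/(p-1)!
  wilson : p ^ 1 ∣ᵖ 1ℚ ℚ.+ u
  wilson = by-cases n refl
    where
    by-cases : ∀ k → k ≡ n → p ^ 1 ∣ᵖ 1ℚ ℚ.+ u
    by-cases zero    refl = contradiction pr ¬prime[1]
    by-cases (suc k) refl = subst (p ^ 1 ∣ᵖ_) (trans (cong (ℚ._- M) total)
        (solve 2 (λ M u → (con 1ℚ :+ (M :+ u)) :- M := con 1ℚ :+ u) refl M u))
      (∣ᵖ-minus pr (subst (p ^ 1 ∣ᵖ_) (solve 1 (λ a → a := con 0ℚ :+ a :* con 1ℚ) refl (p /1)) p∣p)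
        (∣ᵖ-∑ pr k λ i i<k → p∣esym-recips i (k ∸ suc i)
          (cong suc (trans (ℕ.+-suc i _) (ℕ.m+[n∸m]≡n i<k)))))
      where
      M = ∑ k (s ∘ suc)
      -- The coefficient of t^0 says F(1) = p, that is, all the s_k add up to p; the middle ones are
      -- multiples of p.
      total : 0ℚ ℚ.+ p /1 ℚ.* 1ℚ ≡ 1ℚ ℚ.+ (M ℚ.+ u)
      total = trans (sym (shift-recips n 0)) (trans (umbral-∑ (recips n) _ (suc n) (s≤s (ℕ.≤-reflexive (length-recips n))))
        (trans (∑-cong (suc n) λ i _ → ℚ.*-identityˡ (s i)) (cong (1ℚ ℚ.+_) (∑-last k (s ∘ suc)))))

  private
    -- The coefficient of t^(k+1) in the Bernoulli polynomial B_p(t).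
    bernoulliTerm : ℕ → ℚ
    bernoulliTerm k = (p C suc k) /1 ℚ.* B (n ∸ k)

    -- The trinomial identity turns C(p, k+1) C(k+1, m) into C(p, m) C(p-m, k+1-m). The factor C(p,
    -- m) comes out, and the Bernoulli recurrence of order p - m = r + 2 is left, in reverse order.
    shift-bernoulliTerm : ∀ m r → m ℕ.+ suc r ≡ n → shift bernoulliTerm m (suc r) ≡ 0ℚ
    shift-bernoulliTerm m r refl = begin
      shift bernoulliTerm m (suc r)
        ≡⟨ ∑-cong (2 ℕ.+ r) term ⟩
      ∑ (2 ℕ.+ r) (λ i → (p C m) /1 ℚ.* g i)
        ≡⟨ ∑-*ˡ (2 ℕ.+ r) ((p C m) /1) g ⟩
      (p C m) /1 ℚ.* ∑ (2 ℕ.+ r) g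
        ≡⟨ cong ((p C m) /1 ℚ.*_) (trans (sym (∑-reverse (2 ℕ.+ r) (λ j → ((2 ℕ.+ r) C j) /1 ℚ.* B j))) (bernoulli-recurrence r)) ⟩
      (p C m) /1 ℚ.* 0ℚ
        ≡⟨ ℚ.*-zeroʳ ((p C m) /1) ⟩
      0ℚ ∎
      where
      open ≡-Reasoning
      g : ℕ → ℚ
      g i = ((2 ℕ.+ r) C (suc r ∸ i)) /1 ℚ.* B (suc r ∸ i)
      term : ∀ i → i < 2 ℕ.+ r → (suc (m ℕ.+ i) C m) /1 ℚ.* bernoulliTerm (m ℕ.+ i) ≡ (p C m) /1 ℚ.* g i
      term i (s≤s i≤r) = begin
        c /1 ℚ.* (d /1 ℚ.* B (n ∸ (m ℕ.+ i)))
          ≡⟨ cong (λ j → c /1 ℚ.* (d /1 ℚ.* B j)) (ℕ.[m+n]∸[m+o]≡n∸o m (suc r) i) ⟩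
        c /1 ℚ.* (d /1 ℚ.* b)
          ≡⟨ solve 3 (λ c d b → c :* (d :* b) := (d :* c) :* b) refl (c /1) (d /1) b ⟩
        d /1 ℚ.* c /1 ℚ.* b
          ≡⟨ cong (ℚ._* b) (trans (sym (/1-* d c)) (trans (cong _/1 dc) (/1-* (p C m) ((2 ℕ.+ r) C suc i)))) ⟩
        (p C m) /1 ℚ.* ((2 ℕ.+ r) C suc i) /1 ℚ.* b
          ≡⟨ cong (λ z → (p C m) /1 ℚ.* z /1 ℚ.* b) (nCk≡nC[n∸k] {suc i} {2 ℕ.+ r} (s≤s i≤r)) ⟩
        (p C m) /1 ℚ.* ((2 ℕ.+ r) C (suc r ∸ i)) /1 ℚ.* b
          ≡⟨ ℚ.*-assoc ((p C m) /1) _ b ⟩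
        (p C m) /1 ℚ.* g i ∎
        where
        c = suc (m ℕ.+ i) C m
        d = p C suc (m ℕ.+ i)
        b = B (suc r ∸ i)
        2+r≡ : suc i ℕ.+ (suc r ∸ i) ≡ 2 ℕ.+ r
        2+r≡ = cong suc (ℕ.m+[n∸m]≡n i≤r)
        dc : d ℕ.* c ≡ (p C m) ℕ.* ((2 ℕ.+ r) C suc i)
        dc = subst (λ k → (p C k) ℕ.* (k C m) ≡ (p C m) ℕ.* ((2 ℕ.+ r) C suc i)) (ℕ.+-suc m i)
          (subst (λ q → (q C (m ℕ.+ suc i)) ℕ.* ((m ℕ.+ suc i) C m) ≡ (q C m) ℕ.* ((2 ℕ.+ r) C suc i)) (ℕ.+-suc m (suc r))
            (subst (λ t → ((m ℕ.+ t) C (m ℕ.+ suc i)) ℕ.* ((m ℕ.+ suc i) C m) ≡ ((m ℕ.+ t) C m) ℕ.* (t C suc i)) 2+r≡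
              (C-trinomial m (suc i) (suc r ∸ i))))

    -- The multiple of the homogeneous solution is chosen with the same top entry as s, so that D n
    -- = 0. The system for D keeps the right-hand side p s_k, now known to be a multiple of p².
    D : ℕ → ℚ
    D k = s k ℚ.- u ℚ.* bernoulliTerm k

    shift-D : ∀ m r → suc m ℕ.+ suc r ≡ n → shift D (suc m) (suc r) ≡ p /1 ℚ.* s (suc m)
    shift-D m r eq = begin
      shift D (suc m) (suc r)
        ≡⟨ ∑-cong (2 ℕ.+ r) (λ i _ → solve 4 (λ c s u x → c :* (s :- u :* x) := c :* s :+ (:- u) :* (c :* x)) refl
             ((suc (suc m ℕ.+ i) C suc m) /1) (s (suc m ℕ.+ i)) u (bernoulliTerm (suc m ℕ.+ i))) ⟩
      ∑ (2 ℕ.+ r) (λ i → fs i ℚ.+ (ℚ.- u) ℚ.* ft i)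
        ≡⟨ ∑-+ (2 ℕ.+ r) fs (λ i → (ℚ.- u) ℚ.* ft i) ⟩
      shift s (suc m) (suc r) ℚ.+ ∑ (2 ℕ.+ r) (λ i → (ℚ.- u) ℚ.* ft i)
        ≡⟨ cong₂ ℚ._+_ (shift-s m (suc r) eq) (trans (∑-*ˡ (2 ℕ.+ r) (ℚ.- u) ft) (cong ((ℚ.- u) ℚ.*_) (shift-bernoulliTerm (suc m) r eq))) ⟩
      p /1 ℚ.* s (suc m) ℚ.+ (ℚ.- u) ℚ.* 0ℚ
        ≡⟨ solve 2 (λ a u → a :+ u :* con 0ℚ := a) refl (p /1 ℚ.* s (suc m)) (ℚ.- u) ⟩
      p /1 ℚ.* s (suc m) ∎
      where
      open ≡-Reasoning
      fs ft : ℕ → ℚ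
      fs i = (suc (suc m ℕ.+ i) C suc m) /1 ℚ.* s (suc m ℕ.+ i)
      ft i = (suc (suc m ℕ.+ i) C suc m) /1 ℚ.* bernoulliTerm (suc m ℕ.+ i)

    Dn≡0 : D n ≡ 0ℚ
    Dn≡0 = trans (cong₂ (λ c k → u ℚ.- u ℚ.* (c /1 ℚ.* B k)) (nCn≡1 p) (ℕ.n∸n≡0 n))
      (solve 1 (λ u → u :- u :* con 1ℚ := con 0ℚ) refl u)

    p²∣D : ∀ m r → suc m ℕ.+ suc r ≡ n → p ^ 2 ∣ᵖ D (suc m)
    p²∣D = shift-triangular D 2
      (λ m r eq → subst (p ^ 2 ∣ᵖ_) (sym (shift-D m r eq)) (∣ᵖ-* pr p∣p (p∣esym-recips m r eq)))
      (λ m r eq → subst (p ^ 2 ∣ᵖ_) (sym (trans (cong ((suc n C suc m) /1 ℚ.*_) Dn≡0) (ℚ.*-zeroʳ ((suc n C suc m) /1)))) (∣ᵖ-0 pr 2))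

  -- Modulo p², s_{m+1} is u C(p, m+2) B_{r+1}. The factor m + 2 turns the binomial into p C(p-1,
  -- m+1), and u C(p-1, m+1) ≡ -1 mod p by Wilson and the sign (-1)^(m+1) = 1.
  esym-recips-bernoulli : ∀ m r → suc m ℕ.+ suc r ≡ n → -1^ suc m ≡ 1ℚ →
    p ^ 2 ∣ᵖ (2 ℕ.+ m) /1 ℚ.* esym (suc m) (recips n) ℚ.+ p /1 ℚ.* B (suc r)
  esym-recips-bernoulli m r eq even = subst (p ^ 2 ∣ᵖ_) combine
    (∣ᵖ-+ pr (∣ᵖ-*ˡ pr a (integral-/1 (2 ℕ.+ m) pr) (p²∣D m r eq))
      (∣ᵖ-* pr p∣p (∣ᵖ-*ʳ pr b 1+uc (integral-B pr (suc r) 2+r<p))))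
    where
    open ≡-Reasoning
    a = (2 ℕ.+ m) /1
    b = B (suc r)
    c = (n C suc m) /1
    d = (p C (2 ℕ.+ m)) /1
    m≤n : suc m ≤ n
    m≤n = ≤⇒< m r eq
    2+r<p : 2 ℕ.+ r < p
    2+r<p = s≤s (subst (2 ℕ.+ r ≤_) eq (s≤s (ℕ.m≤n+m (suc r) m)))
    1+uc : p ^ 1 ∣ᵖ 1ℚ ℚ.+ u ℚ.* c
    1+uc = subst (p ^ 1 ∣ᵖ_) (solve 2 (λ u c → (con 1ℚ :+ u) :+ u :* (c :- con 1ℚ) := con 1ℚ :+ u :* c) refl u c)
      (∣ᵖ-+ pr wilson (∣ᵖ-*ˡ pr u (integral-esym-recips pr n)
        (subst (λ e → p ^ 1 ∣ᵖ c ℚ.- e) even (C-sign pr (suc m) m≤n))))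
    ad≡pc : a ℚ.* d ≡ p /1 ℚ.* c
    ad≡pc = trans (sym (/1-* (2 ℕ.+ m) (p C (2 ℕ.+ m)))) (trans (cong _/1 (C-absorption m≤n)) (/1-* p (n C suc m)))
    n∸m : n ∸ suc m ≡ suc r
    n∸m = trans (cong (_∸ suc m) (sym eq)) (ℕ.m+n∸m≡n (suc m) (suc r))
    combine : a ℚ.* D (suc m) ℚ.+ p /1 ℚ.* ((1ℚ ℚ.+ u ℚ.* c) ℚ.* b) ≡ a ℚ.* s (suc m) ℚ.+ p /1 ℚ.* b
    combine = begin
      a ℚ.* (s (suc m) ℚ.- u ℚ.* (d ℚ.* B (n ∸ suc m))) ℚ.+ p /1 ℚ.* ((1ℚ ℚ.+ u ℚ.* c) ℚ.* b)
        ≡⟨ cong (λ j → a ℚ.* (s (suc m) ℚ.- u ℚ.* (d ℚ.* B j)) ℚ.+ p /1 ℚ.* ((1ℚ ℚ.+ u ℚ.* c) ℚ.* b)) n∸m ⟩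
      a ℚ.* (s (suc m) ℚ.- u ℚ.* (d ℚ.* b)) ℚ.+ p /1 ℚ.* ((1ℚ ℚ.+ u ℚ.* c) ℚ.* b)
        ≡⟨ solve 7 (λ a s u d b q c → a :* (s :- u :* (d :* b)) :+ q :* ((con 1ℚ :+ u :* c) :* b)
             := a :* s :+ q :* b :+ u :* b :* (q :* c :- a :* d)) refl a (s (suc m)) u d b (p /1) c ⟩
      a ℚ.* s (suc m) ℚ.+ p /1 ℚ.* b ℚ.+ u ℚ.* b ℚ.* (p /1 ℚ.* c ℚ.- a ℚ.* d)
        ≡⟨ cong (λ z → a ℚ.* s (suc m) ℚ.+ p /1 ℚ.* b ℚ.+ u ℚ.* b ℚ.* (p /1 ℚ.* c ℚ.- z)) ad≡pc ⟩
      a ℚ.* s (suc m) ℚ.+ p /1 ℚ.* b ℚ.+ u ℚ.* b ℚ.* (p /1 ℚ.* c ℚ.- p /1 ℚ.* c)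
        ≡⟨ solve 3 (λ x y z → x :+ y :* (z :- z) := x) refl (a ℚ.* s (suc m) ℚ.+ p /1 ℚ.* b) (u ℚ.* b) (p /1 ℚ.* c) ⟩
      a ℚ.* s (suc m) ℚ.+ p /1 ℚ.* b ∎


-- Polynomials: evaluation and substitution

module RP {X : Set} = RingProperties (CommutativeRing.ring (Poly-commutativeRing X))
module PolySolver {X : Set} = NaturalCoefficients (CommutativeRing.commutativeSemiring (Poly-commutativeRing X))
open PolySolver using () renaming (solve to ≈-solve; _:=_ to _⊜_; _:+_ to _⊕_; _:*_ to _⊛_)

≡⇒≈ : {f g : Poly X} → f ≡ g → f ≈ g
≡⇒≈ refl = ≈-refl

module ≈-Reasoning {X : Set} where
  open import Relation.Binary.Reasoning.Setoid (CommutativeRing.setoid (Poly-commutativeRing X)) public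

const-neg : ∀ a → const {X} (ℚ.- a) ≈ - const a
const-neg a = RP.+-inverseʳ-unique (const a) (const (ℚ.- a))
  (≈-trans (≈-sym (const-+ a (ℚ.- a))) (≡⇒≈ (cong const (ℚ.+-inverseʳ a))))

eval-cong : ∀ (ρ : X → ℚ) {f g} → f ≈ g → eval ρ f ≡ eval ρ g
eval-cong ρ ≈-refl             = refl
eval-cong ρ (≈-sym p)          = sym (eval-cong ρ p)
eval-cong ρ (≈-trans p q)      = trans (eval-cong ρ p) (eval-cong ρ q)
eval-cong ρ (+-cong p q)       = cong₂ ℚ._+_ (eval-cong ρ p) (eval-cong ρ q)
eval-cong ρ (*-cong p q)       = cong₂ ℚ._*_ (eval-cong ρ p) (eval-cong ρ q)
eval-cong ρ (-‿cong p)         = cong ℚ.-_ (eval-cong ρ p)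
eval-cong ρ (+-assoc f g h)    = ℚ.+-assoc (eval ρ f) (eval ρ g) (eval ρ h)
eval-cong ρ (+-comm f g)       = ℚ.+-comm (eval ρ f) (eval ρ g)
eval-cong ρ (+-identityˡ f)    = ℚ.+-identityˡ (eval ρ f)
eval-cong ρ (-‿inverseˡ f)     = ℚ.+-inverseˡ (eval ρ f)
eval-cong ρ (*-assoc f g h)    = ℚ.*-assoc (eval ρ f) (eval ρ g) (eval ρ h)
eval-cong ρ (*-comm f g)       = ℚ.*-comm (eval ρ f) (eval ρ g)
eval-cong ρ (*-identityˡ f)    = ℚ.*-identityˡ (eval ρ f)
eval-cong ρ (distribʳ f g h)   = ℚ.*-distribʳ-+ (eval ρ f) (eval ρ g) (eval ρ h)
eval-cong ρ (const-+ a b)      = refl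
eval-cong ρ (const-* a b)      = refl

eval-ext : {ρ σ : X → ℚ} → (∀ x → ρ x ≡ σ x) → ∀ f → eval ρ f ≡ eval σ f
eval-ext eq (const c) = refl
eval-ext eq (var x)   = eq x
eval-ext eq (f + g)   = cong₂ ℚ._+_ (eval-ext eq f) (eval-ext eq g)
eval-ext eq (f * g)   = cong₂ ℚ._*_ (eval-ext eq f) (eval-ext eq g)
eval-ext eq (- f)     = cong ℚ.-_ (eval-ext eq f)

infixl 9 _[_]
_[_] : Poly X → (X → Poly Y) → Poly Y
const c [ σ ] = const c
var x   [ σ ] = σ x
(f + g) [ σ ] = f [ σ ] + (g [ σ ])
(f * g) [ σ ] = (f [ σ ]) * (g [ σ ])
(- f)   [ σ ] = - (f [ σ ])

[]-cong : (σ : X → Poly Y) → ∀ {f g} → f ≈ g → f [ σ ] ≈ g [ σ ]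
[]-cong σ ≈-refl             = ≈-refl
[]-cong σ (≈-sym p)          = ≈-sym ([]-cong σ p)
[]-cong σ (≈-trans p q)      = ≈-trans ([]-cong σ p) ([]-cong σ q)
[]-cong σ (+-cong p q)       = +-cong ([]-cong σ p) ([]-cong σ q)
[]-cong σ (*-cong p q)       = *-cong ([]-cong σ p) ([]-cong σ q)
[]-cong σ (-‿cong p)         = -‿cong ([]-cong σ p)
[]-cong σ (+-assoc f g h)    = +-assoc _ _ _
[]-cong σ (+-comm f g)       = +-comm _ _
[]-cong σ (+-identityˡ f)    = +-identityˡ _
[]-cong σ (-‿inverseˡ f)     = -‿inverseˡ _
[]-cong σ (*-assoc f g h)    = *-assoc _ _ _
[]-cong σ (*-comm f g)       = *-comm _ _
[]-cong σ (*-identityˡ f)    = *-identityˡ _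
[]-cong σ (distribʳ f g h)   = distribʳ _ _ _
[]-cong σ (const-+ a b)      = const-+ a b
[]-cong σ (const-* a b)      = const-* a b

eval-[] : ∀ (ρ : Y → ℚ) (σ : X → Poly Y) f → eval ρ (f [ σ ]) ≡ eval (eval ρ ∘ σ) f
eval-[] ρ σ (const c) = refl
eval-[] ρ σ (var x)   = refl
eval-[] ρ σ (f + g)   = cong₂ ℚ._+_ (eval-[] ρ σ f) (eval-[] ρ σ g)
eval-[] ρ σ (f * g)   = cong₂ ℚ._*_ (eval-[] ρ σ f) (eval-[] ρ σ g)
eval-[] ρ σ (- f)     = cong ℚ.-_ (eval-[] ρ σ f)

-- Cauchy products

cauchy-zeroˡ : ∀ {a : ℕ → Poly X} b m → (∀ i → a i ≈ 0#) → cauchy a b m ≈ 0#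
cauchy-zeroˡ b zero    z = ≈-trans (R.*-congʳ (z 0)) (R.zeroˡ _)
cauchy-zeroˡ b (suc m) z = ≈-trans
  (+-cong (≈-trans (R.*-congʳ (z 0)) (R.zeroˡ _)) (cauchy-zeroˡ b m (z ∘ suc))) (R.+-identityˡ 0#)

cauchy-distribʳ : ∀ (a b c : ℕ → Poly X) m → cauchy (λ i → a i + b i) c m ≈ cauchy a c m + cauchy b c m
cauchy-distribʳ a b c zero    = distribʳ _ _ _
cauchy-distribʳ a b c (suc m) = ≈-trans (R.+-congˡ (cauchy-distribʳ (a ∘ suc) (b ∘ suc) c m))
  (≈-solve 5 (λ x y z u v → (x ⊕ y) ⊛ z ⊕ (u ⊕ v) ⊜ (x ⊛ z ⊕ u) ⊕ (y ⊛ z ⊕ v)) ≈-refl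
    (a 0) (b 0) (c (suc m)) (cauchy (a ∘ suc) c m) (cauchy (b ∘ suc) c m))

cauchy-scale : ∀ g (a b : ℕ → Poly X) m → cauchy (λ i → g * a i) b m ≈ g * cauchy a b m
cauchy-scale g a b zero    = *-assoc _ _ _
cauchy-scale g a b (suc m) = ≈-trans (R.+-congˡ (cauchy-scale g (a ∘ suc) b m))
  (≈-solve 4 (λ g x y z → (g ⊛ x) ⊛ y ⊕ g ⊛ z ⊜ g ⊛ (x ⊛ y ⊕ z)) ≈-refl g (a 0) (b (suc m)) (cauchy (a ∘ suc) b m))

cauchy-sucʳ : ∀ (a b : ℕ → Poly X) m → cauchy a b (suc m) ≈ cauchy a (b ∘ suc) m + a (suc m) * b 0
cauchy-sucʳ a b zero    = ≈-refl
cauchy-sucʳ a b (suc m) = ≈-trans (R.+-congˡ (cauchy-sucʳ (a ∘ suc) b m)) (≈-sym (+-assoc _ _ _))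

cauchy-comm : ∀ (a b : ℕ → Poly X) m → cauchy a b m ≈ cauchy b a m
cauchy-comm a b zero    = *-comm _ _
cauchy-comm a b (suc m) = ≈-trans (R.+-congˡ (cauchy-comm (a ∘ suc) b m)) (≈-trans
  (≈-solve 3 (λ x y z → x ⊛ y ⊕ z ⊜ z ⊕ y ⊛ x) ≈-refl (a 0) (b (suc m)) (cauchy b (a ∘ suc) m))
  (≈-sym (cauchy-sucʳ b a m)))

cauchy-cong′ : ∀ {a a′ b b′ : ℕ → Poly X} m → (∀ i → a i ≈ a′ i) → (∀ i → b i ≈ b′ i) → cauchy a b m ≈ cauchy a′ b′ m
cauchy-cong′ m p q = cauchy-cong m (λ i _ → p i) (λ i _ → q i)

cauchy-assoc : ∀ (a b c : ℕ → Poly X) m → cauchy (cauchy a b) c m ≈ cauchy a (cauchy b c) m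
cauchy-assoc a b c zero    = *-assoc _ _ _
cauchy-assoc a b c (suc m) = begin
  (a 0 * b 0) * c (suc m) + cauchy (λ i → a 0 * b (suc i) + cauchy (a ∘ suc) b i) c m
    ≈⟨ R.+-congˡ (≈-trans (cauchy-distribʳ (λ i → a 0 * b (suc i)) (cauchy (a ∘ suc) b) c m)
         (+-cong (cauchy-scale (a 0) (b ∘ suc) c m) (cauchy-assoc (a ∘ suc) b c m))) ⟩
  (a 0 * b 0) * c (suc m) + (a 0 * cauchy (b ∘ suc) c m + cauchy (a ∘ suc) (cauchy b c) m)
    ≈⟨ ≈-solve 5 (λ x y z u v → (x ⊛ y) ⊛ z ⊕ (x ⊛ u ⊕ v) ⊜ x ⊛ (y ⊛ z ⊕ u) ⊕ v) ≈-refl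
         (a 0) (b 0) (c (suc m)) (cauchy (b ∘ suc) c m) (cauchy (a ∘ suc) (cauchy b c) m) ⟩
  a 0 * (b 0 * c (suc m) + cauchy (b ∘ suc) c m) + cauchy (a ∘ suc) (cauchy b c) m ∎
  where open ≈-Reasoning

cauchy-const : ∀ (w : X → ℕ) c b m → cauchy (component w (const c)) b m ≈ const c * b m
cauchy-const w c b zero    = ≈-refl
cauchy-const w c b (suc m) = ≈-trans (R.+-congˡ (cauchy-zeroˡ b m λ _ → ≈-refl)) (R.+-identityʳ _)

component-0# : ∀ (w : X → ℕ) m → component w 0# m ≈ 0#
component-0# w zero    = ≈-refl
component-0# w (suc m) = ≈-refl

component-cong : ∀ (w : X → ℕ) {f g} → f ≈ g → ∀ m → component w f m ≈ component w g m
component-cong w ≈-refl           m = ≈-refl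
component-cong w (≈-sym p)        m = ≈-sym (component-cong w p m)
component-cong w (≈-trans p q)    m = ≈-trans (component-cong w p m) (component-cong w q m)
component-cong w (+-cong p q)     m = +-cong (component-cong w p m) (component-cong w q m)
component-cong w (*-cong p q)     m = cauchy-cong′ m (component-cong w p) (component-cong w q)
component-cong w (-‿cong p)       m = -‿cong (component-cong w p m)
component-cong w (+-assoc f g h)  m = +-assoc _ _ _
component-cong w (+-comm f g)     m = +-comm _ _
component-cong w (+-identityˡ f)  m = ≈-trans (R.+-congʳ (component-0# w m)) (+-identityˡ _)
component-cong w (-‿inverseˡ f)   m = ≈-trans (-‿inverseˡ _) (≈-sym (component-0# w m))
component-cong w (*-assoc f g h)  m = cauchy-assoc _ _ _ m
component-cong w (*-comm f g)     m = cauchy-comm _ _ m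
component-cong w (*-identityˡ f)  m = ≈-trans (cauchy-const w 1ℚ _ m) (*-identityˡ _)
component-cong w (distribʳ f g h) m = cauchy-distribʳ _ _ _ m
component-cong w (const-+ a b) zero    = const-+ a b
component-cong w (const-+ a b) (suc m) = ≈-sym (+-identityˡ 0#)
component-cong w (const-* a b) zero    = const-* a b
component-cong w (const-* a b) (suc m) = ≈-sym (≈-trans (cauchy-const w a _ (suc m)) (R.zeroʳ (const a)))

-- The Boolean test makes `component w (var x)` equal to `δ (w x) (var x)` by computation.
δ : ℕ → Poly X → ℕ → Poly X
δ d f m = if d ℕ.≡ᵇ m then f else 0#

δ-≡ : ∀ d {f : Poly X} → δ d f d ≈ f
δ-≡ zero    = ≈-refl
δ-≡ (suc d) = δ-≡ d

δ-≢ : ∀ d {f : Poly X} m → d ≢ m → δ d f m ≈ 0#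
δ-≢ zero    zero    d≢m = contradiction refl d≢m
δ-≢ zero    (suc m) d≢m = ≈-refl
δ-≢ (suc d) zero    d≢m = ≈-refl
δ-≢ (suc d) (suc m) d≢m = δ-≢ d m (d≢m ∘ cong suc)

δ-*ˡ : ∀ d (f g : Poly X) m → f * δ d g m ≈ δ d (f * g) m
δ-*ˡ d f g m with d ℕ.≡ᵇ m
... | true  = ≈-refl
... | false = R.zeroʳ f

cauchy-δ : ∀ d d′ (f g : Poly X) m → cauchy (δ d f) (δ d′ g) m ≈ δ (d ℕ.+ d′) (f * g) m
cauchy-δ zero    d′ f g zero    = δ-*ˡ d′ f g 0
cauchy-δ zero    d′ f g (suc m) = ≈-trans (R.+-congˡ (cauchy-zeroˡ (δ d′ g) m λ _ → ≈-refl))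
  (≈-trans (R.+-identityʳ _) (δ-*ˡ d′ f g (suc m)))
cauchy-δ (suc d) d′ f g zero    = R.zeroˡ _
cauchy-δ (suc d) d′ f g (suc m) = ≈-trans (+-cong (R.zeroˡ _) (cauchy-δ d d′ f g m)) (+-identityˡ _)

-- Expansion into monomials

mono : List X → Poly X
mono []       = 1#
mono (x ∷ xs) = var x * mono xs

degree : (X → ℕ) → List X → ℕ
degree w []       = 0
degree w (x ∷ xs) = w x ℕ.+ degree w xs

mono-++ : ∀ (xs ys : List X) → mono (xs ++ ys) ≈ mono xs * mono ys
mono-++ []       ys = ≈-sym (*-identityˡ _)
mono-++ (x ∷ xs) ys = ≈-trans (R.*-congˡ (mono-++ xs ys)) (≈-sym (*-assoc _ _ _))

component-mono : ∀ (w : X → ℕ) xs m → component w (mono xs) m ≈ δ (degree w xs) (mono xs) m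
component-mono w []       zero    = ≈-refl
component-mono w []       (suc m) = ≈-refl
component-mono w (x ∷ xs) m = ≈-trans (cauchy-cong′ m (λ _ → ≈-refl) (component-mono w xs))
  (cauchy-δ (w x) (degree w xs) (var x) (mono xs) m)

component-term : ∀ (w : X → ℕ) c xs m → component w (const c * mono xs) m ≈ δ (degree w xs) (const c * mono xs) m
component-term w c xs m = ≈-trans (cauchy-const w c _ m)
  (≈-trans (R.*-congˡ (component-mono w xs m)) (δ-*ˡ (degree w xs) (const c) (mono xs) m))

-- The predicate on monomials covers homogeneity (degree equal to m) as well as the filtration
-- (degree at least n), and both then allow induction term by term.
data Span (P : List X → Set) : Pred (Poly X) 0ℓ where
  zero : Span P 0#
  term : ∀ c xs {f} → P xs → Span P f → Span P (const c * mono xs + f)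
  resp : ∀ {f g} → f ≈ g → Span P f → Span P g

module _ {P : List X → Set} where

  span-+ : ∀ {f g} → Span P f → Span P g → Span P (f + g)
  span-+ zero              s = resp (≈-sym (+-identityˡ _)) s
  span-+ (term c xs Pxs r) s = resp (≈-sym (+-assoc _ _ _)) (term c xs Pxs (span-+ r s))
  span-+ (resp eq r)       s = resp (R.+-congʳ eq) (span-+ r s)

  span-term : ∀ c xs → P xs → Span P (const c * mono xs)
  span-term c xs Pxs = resp (R.+-identityʳ _) (term c xs Pxs zero)

  span-neg : ∀ {f} → Span P f → Span P (- f)
  span-neg zero = resp (const-neg 0ℚ) zero
  span-neg (term c xs Pxs s) = resp
    (≈-trans (R.+-congʳ (≈-trans (R.*-congʳ (const-neg c)) (≈-sym (RP.-‿distribˡ-* (const c) (mono xs)))))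
      (RP.-‿+-comm _ _))
    (term (ℚ.- c) xs Pxs (span-neg s))
  span-neg (resp eq s) = resp (-‿cong eq) (span-neg s)

span-* : {f g : Poly X} → Span (λ _ → ⊤) f → Span (λ _ → ⊤) g → Span (λ _ → ⊤) (f * g)
span-* zero s = resp (≈-sym (R.zeroˡ _)) zero
span-* (term c xs _ r) s = resp (≈-sym (distribʳ _ _ _)) (span-+ (scale s) (span-* r s))
  where
  scale : ∀ {g} → Span (λ _ → ⊤) g → Span (λ _ → ⊤) (const c * mono xs * g)
  scale zero = resp (≈-sym (R.zeroʳ _)) zero
  scale (term d ys {g} _ s) = resp
    (≈-trans (R.+-congʳ (*-cong (const-* c d) (mono-++ xs ys)))
      (≈-solve 5 (λ c d x y z → (c ⊛ d) ⊛ (x ⊛ y) ⊕ (c ⊛ x) ⊛ z ⊜ (c ⊛ x) ⊛ (d ⊛ y ⊕ z)) ≈-refl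
        (const c) (const d) (mono xs) (mono ys) g))
    (term (c ℚ.* d) (xs ++ ys) tt (scale s))
  scale (resp eq s) = resp (R.*-congˡ eq) (scale s)
span-* (resp eq r) s = resp (R.*-congʳ eq) (span-* r s)

span : (f : Poly X) → Span (λ _ → ⊤) f
span (const c) = resp (R.*-identityʳ _) (span-term c [] tt)
span (var x)   = resp (≈-trans (*-identityˡ _) (R.*-identityʳ _)) (span-term 1ℚ (x ∷ []) tt)
span (f + g)   = span-+ (span f) (span g)
span (f * g)   = span-* (span f) (span g)
span (- f)     = span-neg (span f)

-- Homogeneous components

Σ<-cong : ∀ n {u v : ℕ → Poly X} → (∀ i → u i ≈ v i) → Σ< n u ≈ Σ< n v
Σ<-cong zero    eq = ≈-refl
Σ<-cong (suc n) eq = +-cong (Σ<-cong n eq) (eq n)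

Σ<-zero : ∀ n {u : ℕ → Poly X} → (∀ i → i < n → u i ≈ 0#) → Σ< n u ≈ 0#
Σ<-zero zero    eq = ≈-refl
Σ<-zero (suc n) eq = ≈-trans (+-cong (Σ<-zero n λ i i<n → eq i (ℕ.m<n⇒m<1+n i<n)) (eq n ℕ.≤-refl)) (+-identityˡ 0#)

Σ<-+ : ∀ n (u v : ℕ → Poly X) → Σ< n (λ i → u i + v i) ≈ Σ< n u + Σ< n v
Σ<-+ zero    u v = ≈-sym (+-identityˡ 0#)
Σ<-+ (suc n) u v = ≈-trans (R.+-congʳ (Σ<-+ n u v))
  (≈-solve 4 (λ a b c d → (a ⊕ b) ⊕ (c ⊕ d) ⊜ (a ⊕ c) ⊕ (b ⊕ d)) ≈-refl (Σ< n u) (Σ< n v) (u n) (v n))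

Σ<-δ : ∀ n d {f : Poly X} → d < n → Σ< n (δ d f) ≈ f
Σ<-δ (suc n) d (s≤s d≤n) with ℕ.m≤n⇒m<n∨m≡n d≤n
... | inj₁ d<n  = ≈-trans (+-cong (Σ<-δ n d d<n) (δ-≢ d n (ℕ.<⇒≢ d<n))) (R.+-identityʳ _)
... | inj₂ refl = ≈-trans (+-cong (Σ<-zero n λ i i<n → δ-≢ d i (ℕ.>⇒≢ i<n)) (δ-≡ d)) (+-identityˡ _)

module _ (w : X → ℕ) where

  span-component : ∀ f m → Span (λ xs → degree w xs ≡ m) (component w f m)
  span-component f m = go (span f)
    where
    go : ∀ {f} → Span (λ _ → ⊤) f → Span (λ xs → degree w xs ≡ m) (component w f m)
    go zero = resp (≈-sym (component-0# w m)) zero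
    go (term c xs _ s) = resp (R.+-congʳ (≈-sym (component-term w c xs m))) (span-+ head (go s))
      where
      head : Span (λ xs → degree w xs ≡ m) (δ (degree w xs) (const c * mono xs) m)
      head with degree w xs ℕ.≟ m
      ... | yes refl = resp (≈-sym (δ-≡ (degree w xs))) (span-term c xs refl)
      ... | no  d≢m  = resp (≈-sym (δ-≢ (degree w xs) m d≢m)) zero
    go (resp eq s) = resp (component-cong w eq m) (go s)

  span⇒homogeneous : ∀ {f m} → Span (λ xs → degree w xs ≡ m) f → Homogeneous w m f
  span⇒homogeneous {m = m} zero = component-0# w m
  span⇒homogeneous (term c xs refl s) =
    +-cong (≈-trans (component-term w c xs (degree w xs)) (δ-≡ (degree w xs))) (span⇒homogeneous s)
  span⇒homogeneous {m = m} (resp eq s) =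
    ≈-trans (component-cong w (≈-sym eq) m) (≈-trans (span⇒homogeneous s) eq)

  component-homogeneous : ∀ f m → Homogeneous w m (component w f m)
  component-homogeneous f m = span⇒homogeneous (span-component f m)

  tail : ∀ n f → ∃[ t ] (Span (λ xs → n ≤ degree w xs) t × f ≈ Σ< n (component w f) + t)
  tail n f = go (span f)
    where
    go : ∀ {f} → Span (λ _ → ⊤) f → ∃[ t ] (Span (λ xs → n ≤ degree w xs) t × f ≈ Σ< n (component w f) + t)
    go zero = 0# , zero , ≈-sym (≈-trans (R.+-congʳ (Σ<-zero n λ i _ → component-0# w i)) (+-identityˡ 0#))
    go (resp eq s) with go s
    ... | t , st , eqt = t , st , ≈-trans (≈-sym eq) (≈-trans eqt (R.+-congʳ (Σ<-cong n (component-cong w eq))))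
    go (term c xs {f} _ s) with go s | degree w xs ℕ.<? n
    ... | t , st , eqt | yes d<n = t , st , (begin
      const c * mono xs + f                                      ≈⟨ +-cong (≈-sym (Σ<-δ n (degree w xs) d<n)) eqt ⟩
      Σ< n (δ (degree w xs) (const c * mono xs)) + (Σ< n (component w f) + t)
        ≈⟨ ≈-trans (≈-sym (+-assoc _ _ _)) (R.+-congʳ (≈-trans
             (R.+-congʳ (Σ<-cong n λ i → ≈-sym (component-term w c xs i))) (≈-sym (Σ<-+ n _ _)))) ⟩
      Σ< n (component w (const c * mono xs + f)) + t             ∎)
      where open ≈-Reasoning
    ... | t , st , eqt | no d≮n = const c * mono xs + t , term c xs (ℕ.≮⇒≥ d≮n) st , (begin
      const c * mono xs + f                                      ≈⟨ R.+-congˡ eqt ⟩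
      const c * mono xs + (Σ< n (component w f) + t)
        ≈⟨ ≈-solve 3 (λ a b c → a ⊕ (b ⊕ c) ⊜ b ⊕ (a ⊕ c)) ≈-refl (const c * mono xs) (Σ< n (component w f)) t ⟩
      Σ< n (component w f) + (const c * mono xs + t)             ≈⟨ R.+-congʳ (≈-sym (≈-trans (Σ<-+ n _ _)
        (≈-trans (R.+-congʳ (Σ<-zero n λ i i<n → ≈-trans (component-term w c xs i)
          (δ-≢ (degree w xs) i (λ d≡i → d≮n (subst (_< n) (sym d≡i) i<n))))) (+-identityˡ _)))) ⟩
      Σ< n (component w (const c * mono xs + f)) + (const c * mono xs + t) ∎)
      where open ≈-Reasoning

  span≥ : ∀ {n f} → (∀ m → m < n → component w f m ≈ 0#) → Span (λ xs → n ≤ degree w xs) f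
  span≥ {n} {f} z with tail n f
  ... | t , st , eq = resp (≈-sym (≈-trans eq (≈-trans (R.+-congʳ (Σ<-zero n z)) (+-identityˡ t)))) st

  Σ<-component : ∀ f → ∃[ N ] (∀ n → N ≤ n → f ≈ Σ< n (component w f))
  Σ<-component f = go (span f)
    where
    go : ∀ {f} → Span (λ _ → ⊤) f → ∃[ N ] (∀ n → N ≤ n → f ≈ Σ< n (component w f))
    go zero = 0 , λ n _ → ≈-sym (Σ<-zero n λ i _ → component-0# w i)
    go (resp eq s) with go s
    ... | N , eqN = N , λ n N≤n → ≈-trans (≈-sym eq) (≈-trans (eqN n N≤n) (Σ<-cong n (component-cong w eq)))
    go (term c xs {f} _ s) with go s
    ... | N , eqN = suc (degree w xs) ℕ.+ N , λ n b → ≈-trans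
      (+-cong (≈-trans (≈-sym (Σ<-δ n (degree w xs) (ℕ.m+n≤o⇒m≤o _ b))) (Σ<-cong n λ i → ≈-sym (component-term w c xs i)))
        (eqN n (ℕ.m+n≤o⇒n≤o (suc (degree w xs)) b)))
      (≈-sym (Σ<-+ n _ _))

  components≈0 : ∀ {f} → (∀ m → component w f m ≈ 0#) → f ≈ 0#
  components≈0 {f} z with Σ<-component f
  ... | N , eq = ≈-trans (eq N ℕ.≤-refl) (Σ<-zero N λ m _ → z m)

  eval-homogeneous : ∀ q (y : X → ℚ) {f m} → Span (λ xs → degree w xs ≡ m) f →
                     eval (λ x → (q ℕ.^ w x) /1 ℚ.* y x) f ≡ (q ℕ.^ m) /1 ℚ.* eval y f
  eval-homogeneous q y {m = m} zero = sym (ℚ.*-zeroʳ ((q ℕ.^ m) /1))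
  eval-homogeneous q y {m = m} (resp eq s) = trans (eval-cong _ (≈-sym eq)) (trans (eval-homogeneous q y s)
    (cong ((q ℕ.^ m) /1 ℚ.*_) (eval-cong y eq)))
  eval-homogeneous q y (term c xs {f} refl s) = trans
    (cong₂ (λ a b → c ℚ.* a ℚ.+ b) (eval-mono xs) (eval-homogeneous q y s))
    (solve 4 (λ c q a b → c :* (q :* a) :+ q :* b := q :* (c :* a :+ b)) refl
      c ((q ℕ.^ degree w xs) /1) (eval y (mono xs)) (eval y f))
    where
    eval-mono : ∀ xs → eval (λ x → (q ℕ.^ w x) /1 ℚ.* y x) (mono xs) ≡ (q ℕ.^ degree w xs) /1 ℚ.* eval y (mono xs)
    eval-mono []       = refl
    eval-mono (x ∷ xs) = trans (cong ((q ℕ.^ w x) /1 ℚ.* y x ℚ.*_) (eval-mono xs)) (trans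
      (solve 4 (λ a b c d → (a :* b) :* (c :* d) := (a :* c) :* (b :* d)) refl
        ((q ℕ.^ w x) /1) (y x) ((q ℕ.^ degree w xs) /1) (eval y (mono xs)))
      (cong (ℚ._* (y x ℚ.* eval y (mono xs))) (sym (trans (cong _/1 (ℕ.^-distribˡ-+-* q (w x) (degree w xs)))
        (/1-* (q ℕ.^ w x) (q ℕ.^ degree w xs))))))

-- Equality with 0 is stable: a polynomial in n + 1 variables is recovered from
-- its components for the degree in the first variable x, each of which is a
-- power of x times a polynomial in the other variables.

δ₀ : ∀ {n} → Fin (suc n) → ℕ
δ₀ Fin.zero    = 1
δ₀ (Fin.suc _) = 0

dehomogenise : ∀ {n} → Fin (suc n) → Poly (Fin n)
dehomogenise Fin.zero    = 1#
dehomogenise (Fin.suc i) = var i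

infixr 8 _^^_
_^^_ : Poly X → ℕ → Poly X
f ^^ zero  = 1#
f ^^ suc n = f * f ^^ n

span-δ₀ : ∀ {n d} {f : Poly (Fin (suc n))} → Span (λ xs → degree δ₀ xs ≡ d) f →
          f ≈ var Fin.zero ^^ d * (f [ dehomogenise ] [ var ∘ Fin.suc ])
span-δ₀ zero = ≈-sym (R.zeroʳ _)
span-δ₀ (resp eq s) = ≈-trans (≈-sym eq) (≈-trans (span-δ₀ s)
  (R.*-congˡ ([]-cong (var ∘ Fin.suc) ([]-cong dehomogenise eq))))
span-δ₀ (term c xs {f} refl s) = ≈-trans (+-cong (R.*-congˡ (mono-δ₀ xs)) (span-δ₀ s))
  (≈-solve 4 (λ c q a b → c ⊛ (q ⊛ a) ⊕ q ⊛ b ⊜ q ⊛ (c ⊛ a ⊕ b)) ≈-refl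
    (const c) (var Fin.zero ^^ degree δ₀ xs) (mono xs [ dehomogenise ] [ var ∘ Fin.suc ]) (f [ dehomogenise ] [ var ∘ Fin.suc ]))
  where
  mono-δ₀ : ∀ {n} (xs : List (Fin (suc n))) →
            mono xs ≈ var Fin.zero ^^ degree δ₀ xs * (mono xs [ dehomogenise ] [ var ∘ Fin.suc ])
  mono-δ₀ []                 = ≈-sym (*-identityˡ _)
  mono-δ₀ (Fin.zero  ∷ xs)   = ≈-trans (R.*-congˡ (mono-δ₀ xs))
    (≈-trans (≈-sym (*-assoc _ _ _)) (R.*-congˡ (≈-sym (*-identityˡ _))))
  mono-δ₀ (Fin.suc i ∷ xs)   = ≈-trans (R.*-congˡ (mono-δ₀ xs))
    (≈-solve 3 (λ a b c → a ⊛ (b ⊛ c) ⊜ b ⊛ (a ⊛ c)) ≈-refl (var (Fin.suc i)) (var Fin.zero ^^ degree δ₀ xs)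
      (mono xs [ dehomogenise ] [ var ∘ Fin.suc ]))

constant : (f : Poly (Fin 0)) → f ≈ const (eval (λ ()) f)
constant (const c) = ≈-refl
constant (f + g)   = ≈-trans (+-cong (constant f) (constant g)) (≈-sym (const-+ _ _))
constant (f * g)   = ≈-trans (*-cong (constant f) (constant g)) (≈-sym (const-* _ _))
constant (- f)     = ≈-trans (-‿cong (constant f)) (≈-sym (const-neg _))

≈0-stable : ∀ {n} (f : Poly (Fin n)) → ¬ ¬ (f ≈ 0#) → f ≈ 0#
≈0-stable {zero}  f ¬¬f≈0 = ≈-trans (constant f) (≡⇒≈ (cong const
  (decidable-stable (eval (λ ()) f ℚ.≟ 0ℚ) λ ≢0 → ¬¬f≈0 (≢0 ∘ eval-cong (λ ())))))
≈0-stable {suc n} f ¬¬f≈0 = components≈0 δ₀ λ d → ≈-trans (span-δ₀ (span-component δ₀ f d))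
  (≈-trans (R.*-congˡ ([]-cong (var ∘ Fin.suc) (≈0-stable (component δ₀ f d [ dehomogenise ])
    λ ≉0 → ¬¬f≈0 λ f≈0 → ≉0 ([]-cong dehomogenise (≈-trans (component-cong δ₀ f≈0 d) (component-0# δ₀ d))))))
    (R.zeroʳ _))

-- Vanishing modulo p^n for almost all primes

eventually₀ : ∀ {P : Pred ℕ 0ℓ} → (∀ p → Prime p → P p) → Eventually P
eventually₀ h = 0 , λ p pr _ → h p pr

eventually₁ : ∀ {P Q : Pred ℕ 0ℓ} → (∀ p → Prime p → P p → Q p) → Eventually P → Eventually Q
eventually₁ h (N , f) = N , λ p pr b → h p pr (f p pr b)

eventually₂ : ∀ {P Q S : Pred ℕ 0ℓ} → (∀ p → Prime p → P p → Q p → S p) → Eventually P → Eventually Q → Eventually S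
eventually₂ h (M , f) (N , g) = M ℕ.+ N , λ p pr b →
  h p pr (f p pr (ℕ.m+n≤o⇒m≤o M b)) (g p pr (ℕ.m+n≤o⇒n≤o M b))

-- Membership in the kernel of Z^[n], in terms of cofactors.
record Vanishes (n : ℕ) (f : Λ) : Set where
  constructor vanishing
  field
    eventually : Eventually λ p → p ^ n ∣ᵖ evalAt (points p) f
open Vanishes

module _ {n : ℕ} where

  vanishes-0# : Vanishes n 0#
  vanishes-0# = vanishing $ eventually₀ λ p pr → ∣ᵖ-0 pr n

  vanishes-+ : ∀ {f g} → Vanishes n f → Vanishes n g → Vanishes n (f + g)
  vanishes-+ (vanishing v) (vanishing w) = vanishing $ eventually₂ (λ p pr → ∣ᵖ-+ pr) v w

  vanishes-neg : ∀ {f} → Vanishes n f → Vanishes n (- f)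
  vanishes-neg (vanishing v) = vanishing $ eventually₁ (λ p pr → ∣ᵖ-neg pr) v

  vanishes-cong : ∀ {f g} → f ≈ g → Vanishes n f → Vanishes n g
  vanishes-cong f≈g (vanishing v) = vanishing $ eventually₁ (λ p pr → subst (p ^ n ∣ᵖ_) (eval-cong _ f≈g)) v

  vanishes-*ˡ : ∀ f {g} → Vanishes n g → Vanishes n (f * g)
  vanishes-*ˡ f (vanishing v) = vanishing $ eventually₂ (λ p pr i → ∣ᵖ-*ˡ pr (evalAt (points p) f) i) (integral-evalAt f) v

  vanishes-weaken : ∀ {m f} → m ≤ n → Vanishes n f → Vanishes m f
  vanishes-weaken m≤n (vanishing v) = vanishing $ eventually₁ (λ p pr → ∣ᵖ-weaken pr m≤n) v

-- The homogeneity of e_{k+1} gives p^(k+1), and p ∣ s_{k+1} gives the additional factor that the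
-- H-degree records. The bound 3 + k on p expresses k + 1 ≤ p - 2.
vanishes-var : ∀ k → Vanishes (Hdeg k) (var k)
vanishes-var k = vanishing $ 3 ℕ.+ k , λ where
  (suc n) pr (s≤s 2+k≤n) → subst (λ e → suc n ^ e ∣ᵖ esym (suc k) (points (suc n))) (cong suc (ℕ.+-comm k 1))
    (subst (suc n ^ suc k ℕ.+ 1 ∣ᵖ_) (sym (esym-points n (suc k)))
      (∣ᵖ-* pr (^∣ᵖ^ pr (suc k)) (p∣esym-recips pr k (n ∸ (2 ℕ.+ k))
        (trans (ℕ.+-suc (suc k) _) (ℕ.m+[n∸m]≡n 2+k≤n)))))

vanishes-mono : ∀ xs → Vanishes (degree Hdeg xs) (mono xs)
vanishes-mono []       = vanishing $ eventually₀ λ p pr → integral⇒∣ᵖ pr {1ℚ} (∤1 pr)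
vanishes-mono (k ∷ xs) = vanishing $ eventually₂ (λ p pr → ∣ᵖ-* pr) (eventually (vanishes-var k)) (eventually (vanishes-mono xs))

vanishes-span : ∀ {n f} → Span (λ xs → n ≤ degree Hdeg xs) f → Vanishes n f
vanishes-span zero              = vanishes-0#
vanishes-span (term c xs n≤d s) =
  vanishes-+ (vanishes-*ˡ (const c) (vanishes-weaken n≤d (vanishes-mono xs))) (vanishes-span s)
vanishes-span (resp eq s)       = vanishes-cong eq (vanishes-span s)

vanishes-𝓘 : ∀ {n f} → 𝓘 n f → Vanishes n f
vanishes-𝓘 f∈𝓘 = vanishes-span (span≥ Hdeg f∈𝓘)

-- Congruence modulo 𝓘 n

minus-cancel : ∀ (f g : Poly X) → (f + - g) + g ≈ f
minus-cancel f g = ≈-trans (+-assoc _ _ _) (≈-trans (R.+-congˡ (-‿inverseˡ g)) (R.+-identityʳ f))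

infix 4 _∼[_]_
record _∼[_]_ (f : Λ) (n : ℕ) (g : Λ) : Set where
  constructor agree
  field
    component-≈ : ∀ m → m < n → component Hdeg f m ≈ component Hdeg g m
open _∼[_]_

mod𝓘⇒∼ : ∀ {n f g} → f ≡ g mod𝓘 n → f ∼[ n ] g
mod𝓘⇒∼ f≡g = agree λ m m<n → diff≈0⇒≈ (f≡g m m<n)

∼⇒mod𝓘 : ∀ {n f g} → f ∼[ n ] g → f ≡ g mod𝓘 n
∼⇒mod𝓘 (agree eq) m m<n = ≈⇒diff≈0 (eq m m<n)

module _ {n : ℕ} where

  ∼-sym : ∀ {f g} → f ∼[ n ] g → g ∼[ n ] f
  ∼-sym (agree p) = agree λ m m<n → ≈-sym (p m m<n)

  ∼-trans : ∀ {f g h} → f ∼[ n ] g → g ∼[ n ] h → f ∼[ n ] h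
  ∼-trans (agree p) (agree q) = agree λ m m<n → ≈-trans (p m m<n) (q m m<n)

  ∼-reflexive : ∀ {f g} → f ≈ g → f ∼[ n ] g
  ∼-reflexive f≈g = agree λ m m<n → component-cong Hdeg f≈g m

  ∼-+ : ∀ {f f′ g g′} → f ∼[ n ] f′ → g ∼[ n ] g′ → f + g ∼[ n ] f′ + g′
  ∼-+ (agree p) (agree q) = agree λ m m<n → +-cong (p m m<n) (q m m<n)

  ∼-* : ∀ {f f′ g g′} → f ∼[ n ] f′ → g ∼[ n ] g′ → f * g ∼[ n ] f′ * g′
  ∼-* (agree p) (agree q) = agree λ m m<n → cauchy-cong m
    (λ i i≤m → p i (ℕ.≤-<-trans i≤m m<n)) (λ i i≤m → q i (ℕ.≤-<-trans i≤m m<n))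

  𝓘⇒∼ : ∀ {f} → 𝓘 n f → 0# ∼[ n ] f
  𝓘⇒∼ f∈𝓘 = agree λ m m<n → ≈-trans (component-0# Hdeg m) (≈-sym (f∈𝓘 m m<n))

  vanishes-∼ : ∀ {f g} → f ∼[ n ] g → Vanishes n f → Vanishes n g
  vanishes-∼ {f} {g} f∼g v = vanishes-cong (minus-cancel g f)
    (vanishes-+ (vanishes-𝓘 {n} {g + - f} (∼⇒mod𝓘 (∼-sym f∼g))) v)

𝓘-≤ : ∀ {m n f} → m ≤ n → 𝓘 n f → 𝓘 m f
𝓘-≤ m≤n f∈𝓘 k k<m = f∈𝓘 k (ℕ.<-≤-trans k<m m≤n)

cauchy-vanish : ∀ {u v : ℕ → Poly X} a {b m} → (∀ i → i < a → u i ≈ 0#) → (∀ i → i < b → v i ≈ 0#) →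
                m < a ℕ.+ b → cauchy u v m ≈ 0#
cauchy-vanish {u = u} {v} zero    {m = m} p q m<b = cauchy-zeroʳ u v m λ i i≤m → q i (ℕ.≤-<-trans i≤m m<b)
cauchy-vanish (suc a) {m = zero}  p q _         = ≈-trans (R.*-congʳ (p 0 (s≤s z≤n))) (R.zeroˡ _)
cauchy-vanish (suc a) {m = suc m} p q (s≤s m<)  = ≈-trans
  (+-cong (≈-trans (R.*-congʳ (p 0 (s≤s z≤n))) (R.zeroˡ _))
    (cauchy-vanish a (λ i i<a → p (suc i) (s≤s i<a)) q m<))
  (+-identityˡ 0#)

𝓘-* : ∀ m {n f g} → 𝓘 m f → 𝓘 n g → 𝓘 (m ℕ.+ n) (f * g)
𝓘-* m f∈ g∈ k = cauchy-vanish m f∈ g∈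

-- The relations β_k

eval-Σ< : ∀ (ρ : X → ℚ) n u → eval ρ (Σ< n u) ≡ ∑ n (eval ρ ∘ u)
eval-Σ< ρ zero    u = refl
eval-Σ< ρ (suc n) u = trans (cong (ℚ._+ eval ρ (u n)) (eval-Σ< ρ n u)) (sym (∑-last n (eval ρ ∘ u)))

evalAt-e : ∀ xs k → evalAt xs (e k) ≡ esym k xs
evalAt-e xs zero    = refl
evalAt-e xs (suc k) = refl

-- The untruncated sum vanishes exactly by the mirror identity. The truncation at level n omits only
-- indices j ≥ k + n, whose terms are multiples of p^j.
evalAt-β : ∀ {q} → Prime (suc q) → 2 < suc q → ∀ k n → suc q ^ n ∣ᵖ evalAt (points (suc q)) (at (β k) n)
evalAt-β {q} pr 2<p k n = subst (p ^ n ∣ᵖ_)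
  (sym (trans value (trans (cong (ℚ._- mid) (trans total (cong (ℚ._+ (mid ℚ.+ high)) low≡0)))
    (solve 2 (λ m h → (con 0ℚ :+ (m :+ h)) :- m := h) refl mid high))))
  (∣ᵖ-∑ pr p λ i _ → let j = k ℕ.+ (n ℕ.+ i) in
    ∣ᵖ-*ˡ pr (signedBinomial k j) (integral-* (-1^ j) ((j C k) /1) pr (integral-sign j) (integral-/1 (j C k) pr))
      (subst (p ^ n ∣ᵖ_) (sym (esym-points q j))
        (∣ᵖ-*ʳ pr (esym j (recips q)) (∣ᵖ-weaken pr (ℕ.≤-trans (ℕ.m≤m+n n i) (ℕ.m≤n+m (n ℕ.+ i) k)) (^∣ᵖ^ pr j))
          (integral-esym-recips pr j))))
  where
  p  = suc q
  xs = points p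
  f : ℕ → ℚ
  f j = signedBinomial k j ℚ.* esym j xs
  low  = ∑ k f
  mid  = ∑ n (λ i → f (k ℕ.+ i))
  high = ∑ p (λ i → f (k ℕ.+ (n ℕ.+ i)))
  integral-sign : ∀ j → Integral p (-1^ j)
  integral-sign zero    = ∤1 pr
  integral-sign (suc j) = integral-neg (-1^ j) (integral-sign j)
  -- Summing p further terms after the truncation certainly passes the p - 1 points, beyond which
  -- every e_j is zero.
  length< : List.length xs < k ℕ.+ (n ℕ.+ p)
  length< = ℕ.<-≤-trans (s≤s (ℕ.≤-reflexive (length-points q))) (ℕ.≤-trans (ℕ.m≤n+m p n) (ℕ.m≤n+m (n ℕ.+ p) k))
  total : esym k xs ≡ low ℚ.+ (mid ℚ.+ high)
  total = trans (sym (esym-points-mirror pr 2<p k)) (trans (umbral-∑ xs (signedBinomial k) (k ℕ.+ (n ℕ.+ p)) length<)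
    (trans (∑-split k (n ℕ.+ p) f) (cong (low ℚ.+_) (∑-split n p (λ i → f (k ℕ.+ i))))))
  low≡0 : low ≡ 0ℚ
  low≡0 = ∑-zero k λ j j<k → trans (cong (λ c → (-1^ j) ℚ.* c /1 ℚ.* esym j xs) (k>n⇒nCk≡0 j<k))
    (solve 2 (λ s x → s :* con 0ℚ :* x := con 0ℚ) refl (-1^ j) (esym j xs))
  value : evalAt xs (at (β k) n) ≡ esym k xs ℚ.- mid
  value = cong₂ ℚ._+_ (evalAt-e xs k) (trans (eval-Σ< _ n (λ i → βterm k (k ℕ.+ i))) (trans
    (∑-cong n λ i _ → trans (cong (((ℚ.- (-1^ (k ℕ.+ i))) ℚ.* ((k ℕ.+ i) C k) /1) ℚ.*_) (evalAt-e xs (k ℕ.+ i)))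
      (solve 3 (λ s c x → (:- s) :* c :* x := (:- con 1ℚ) :* (s :* c :* x)) refl
        (-1^ (k ℕ.+ i)) (((k ℕ.+ i) C k) /1) (esym (k ℕ.+ i) xs)))
    (trans (∑-*ˡ n (ℚ.- 1ℚ) (λ i → f (k ℕ.+ i))) (solve 1 (λ m → (:- con 1ℚ) :* m := :- m) refl mid))))

vanishes-β : ∀ k n → Vanishes n (at (β k) n)
vanishes-β k n = vanishing $ 3 , λ where
  (suc q) pr 2<p → evalAt-β pr 2<p k n

vanishes-Iβ : ∀ {g} → Iβ g → ∀ n → Vanishes n (at g n)
vanishes-Iβ (gen k)      n = vanishes-β k n
vanishes-Iβ zero         n = vanishes-0#
vanishes-Iβ (add g∈ h∈)  n = vanishes-+ (vanishes-Iβ g∈ n) (vanishes-Iβ h∈ n)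
vanishes-Iβ (mul f g∈)   n = vanishes-*ˡ (at f n) (vanishes-Iβ g∈ n)
vanishes-Iβ (resp eq g∈) n = vanishes-∼ (mod𝓘⇒∼ (eq n)) (vanishes-Iβ g∈ n)

Closure⊆KerẐ : Closure Iβ ⊆ KerẐ
Closure⊆KerẐ {f} f∈ n with f∈ n
... | g , g∈ , g≡f = eventually₁ (λ p pr → ∣ᵖ⇒mod pr) (eventually (vanishes-∼ (mod𝓘⇒∼ {n} {at g n} {at f n} g≡f) (vanishes-Iβ g∈ n)))

KerẐ⇒vanishes : ∀ {f} → KerẐ f → ∀ n → Vanishes n (at f n)
KerẐ⇒vanishes f∈ n = vanishing $ eventually₁ (λ p pr → mod⇒∣ᵖ pr) (f∈ n)

-- Reduction modulo I_β to polynomials in the even e_k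

Iβ-mod : ℕ → Pred Λ 0ℓ
Iβ-mod n f = ∃[ g ] (Iβ g × at g n ∼[ n ] f)

Iβ-mod-+ : ∀ {n f g} → Iβ-mod n f → Iβ-mod n g → Iβ-mod n (f + g)
Iβ-mod-+ (f̂ , f̂∈ , p) (ĝ , ĝ∈ , q) = f̂ +̂ ĝ , add f̂∈ ĝ∈ , ∼-+ p q

Iβ-mod-*ˡ : ∀ {n} f {g} → Iβ-mod n g → Iβ-mod n (f * g)
Iβ-mod-*ˡ f (ĝ , ĝ∈ , q) = ι f *̂ ĝ , mul (ι f) ĝ∈ , ∼-* (∼-reflexive ≈-refl) q

Iβ-mod-cong : ∀ {n f g} → f ≈ g → Iβ-mod n f → Iβ-mod n g
Iβ-mod-cong f≈g (f̂ , f̂∈ , p) = f̂ , f̂∈ , ∼-trans p (∼-reflexive f≈g)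

Iβ-mod-𝓘 : ∀ {n f} → 𝓘 n f → Iβ-mod n f
Iβ-mod-𝓘 f∈𝓘 = ι 0# , zero , 𝓘⇒∼ f∈𝓘

vanishes-Iβ-mod : ∀ {n f} → Iβ-mod n f → Vanishes n f
vanishes-Iβ-mod {n} (g , g∈ , g∼f) = vanishes-∼ g∼f (vanishes-Iβ g∈ n)

-- By the Bernoulli congruence, the image of x_{2i+3} under evenVars takes the
-- value p^{2i+3} B_{p-2i-3} at p/1, …, p/(p-1), up to higher powers of p.
evenVars : ∀ {M} → Fin M → Λ
evenVars i = const (ℚ.- (label i /1)) * var (1 ℕ.+ 2 ℕ.* toℕ i)

-- Here f lies in I_β + 𝓘 n up to a polynomial in M of the even e_k. The number of variables is
-- finite because (BC) applies to the remainder.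
record Reducible (n M : ℕ) (f : Λ) : Set where
  constructor reducible
  field
    {ideal}   : Λ
    remainder : Poly (Fin M)
    ideal∈    : Iβ-mod n ideal
    split     : f ≈ ideal + remainder [ evenVars ]

module _ {n M : ℕ} where

  private
    Red = Reducible n M

    zero∈ : Iβ-mod n 0#
    zero∈ = Iβ-mod-𝓘 λ m _ → component-0# Hdeg m

  red-Iβ : ∀ {f} → Iβ-mod n f → Red f
  red-Iβ f∈ = reducible 0# f∈ (≈-sym (R.+-identityʳ _))

  red-poly : ∀ r → Red (r [ evenVars ])
  red-poly r = reducible r zero∈ (≈-sym (+-identityˡ _))

  red-cong : ∀ {f g} → f ≈ g → Red f → Red g
  red-cong f≈g (reducible r j eq) = reducible r j (≈-trans (≈-sym f≈g) eq)

  red-+ : ∀ {f g} → Red f → Red g → Red (f + g)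
  red-+ (reducible {a} r j eq) (reducible {b} s k eq′) = reducible (r + s) (Iβ-mod-+ j k)
    (≈-trans (+-cong eq eq′) (≈-solve 4 (λ a r b s → (a ⊕ r) ⊕ (b ⊕ s) ⊜ (a ⊕ b) ⊕ (r ⊕ s)) ≈-refl
      a (r [ evenVars ]) b (s [ evenVars ])))

  red-* : ∀ {f g} → Red f → Red g → Red (f * g)
  red-* (reducible {a} r j eq) (reducible {b} s k eq′) =
    reducible (r * s) (Iβ-mod-+ (Iβ-mod-*ˡ (b + s [ evenVars ]) j) (Iβ-mod-*ˡ (r [ evenVars ]) k))
    (≈-trans (*-cong eq eq′) (≈-solve 4 (λ a r b s → (a ⊕ r) ⊛ (b ⊕ s) ⊜ ((b ⊕ s) ⊛ a ⊕ r ⊛ b) ⊕ r ⊛ s) ≈-refl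
      a (r [ evenVars ]) b (s [ evenVars ])))

  red-const : ∀ c → Red (const c)
  red-const c = red-poly (const c)

  red-neg : ∀ {f} → Red f → Red (- f)
  red-neg {f} red = red-cong (≈-trans (R.*-congʳ (const-neg 1ℚ)) (RP.-1*x≈-x f)) (red-* (red-const (ℚ.- 1ℚ)) red)

  red-Σ< : ∀ m {u} → (∀ i → Red (u i)) → Red (Σ< m u)
  red-Σ< zero    reds = red-const 0ℚ
  red-Σ< (suc m) reds = red-+ (red-Σ< m reds) (reds m)

Σ<-head : ∀ n (u : ℕ → Poly X) → Σ< (suc n) u ≈ u 0 + Σ< n (u ∘ suc)
Σ<-head zero    u = R.+-comm _ _
Σ<-head (suc n) u = ≈-trans (R.+-congʳ (Σ<-head n u)) (+-assoc _ _ _)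

parity : ∀ j → (∃[ i ] j ≡ 2 ℕ.* i) ⊎ (∃[ i ] j ≡ 1 ℕ.+ 2 ℕ.* i)
parity zero = inj₁ (0 , refl)
parity (suc j) with parity j
... | inj₁ (i , refl) = inj₂ (i , refl)
... | inj₂ (i , refl) = inj₁ (suc i , cong suc (sym (ℕ.+-suc i (i ℕ.+ 0))))

-1^-even : ∀ i → -1^ (2 ℕ.* i) ≡ 1ℚ
-1^-even zero    = refl
-1^-even (suc i) = trans (cong (λ k → ℚ.- (-1^ k)) (ℕ.+-suc i (i ℕ.+ 0)))
  (trans (solve 1 (λ a → :- (:- a) := a) refl (-1^ (2 ℕ.* i))) (-1^-even i))

βterm-diagonal : ∀ k {j} → -1^ k ≡ 1ℚ → j ≡ k → βterm k j ≈ - e k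
βterm-diagonal k even refl = ≈-trans
  (R.*-congʳ (≈-trans (≡⇒≈ (cong const (cong₂ (λ s c → (ℚ.- s) ℚ.* c /1) even (nCn≡1 k)))) (const-neg 1ℚ))) (RP.-1*x≈-x (e k))

βterm-next : ∀ k {j} → -1^ k ≡ 1ℚ → j ≡ suc k → βterm k j ≈ const (suc k /1) * e (suc k)
βterm-next k even refl = R.*-congʳ (≡⇒≈ (cong const (trans
  (cong₂ (λ s c → (ℚ.- (ℚ.- s)) ℚ.* c /1) even (C-pred k)) (ℚ.*-identityˡ (suc k /1)))))

-- For even k, the terms of β_k with e_k cancel and (k+1) e_{k+1} becomes the
-- leading one, so that β_k eliminates e_{k+1}.
β-leading : ∀ k n → -1^ k ≡ 1ℚ →
  at (β k) (2 ℕ.+ n) ≈ const (suc k /1) * e (suc k) + Σ< n (λ i → βterm k (k ℕ.+ (2 ℕ.+ i)))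
β-leading k n even = begin
  e k + Σ< (2 ℕ.+ n) u                               ≈⟨ R.+-congˡ (≈-trans (Σ<-head (suc n) u) (R.+-congˡ (Σ<-head n (u ∘ suc)))) ⟩
  e k + (u 0 + (u 1 + rest))                         ≈⟨ ≈-sym (+-assoc _ _ _) ⟩
  (e k + u 0) + (u 1 + rest)                         ≈⟨ +-cong (R.+-congˡ (βterm-diagonal k even (ℕ.+-identityʳ k)))
                                                               (R.+-congʳ (βterm-next k even (ℕ.+-comm k 1))) ⟩
  (e k + - e k) + (const (suc k /1) * e (suc k) + rest) ≈⟨ R.+-congʳ (R.-‿inverseʳ (e k)) ⟩
  0# + (const (suc k /1) * e (suc k) + rest)         ≈⟨ +-identityˡ _ ⟩
  const (suc k /1) * e (suc k) + rest                ∎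
  where
  open ≈-Reasoning
  u : ℕ → Λ
  u i = βterm k (k ℕ.+ i)
  rest = Σ< n (u ∘ suc ∘ suc)

const-inverse : ∀ k (f : Poly X) → const (+ 1 / suc k) * (const (suc k /1) * f) ≈ f
const-inverse k f = ≈-trans (≈-sym (*-assoc _ _ _)) (≈-trans
  (R.*-congʳ (≈-trans (≈-sym (const-* _ _)) (≡⇒≈ (cong const (trans (ℚ.*-comm (+ 1 / suc k) (suc k /1)) (/1-inverse k))))))
  (*-identityˡ f))

module _ (n : ℕ) where

  private
    Red = Reducible n n

    red-large : ∀ {j} → n ≤ j → Red (e j)
    red-large {j} n≤j = red-Iβ (Iβ-mod-𝓘 (𝓘-≤ {f = e j} n≤j (e∈𝓘 j)))

  -- A crude cutoff suffices: for i ≥ n the element e_{2i+2} already lies in 𝓘 n, so n variables are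
  -- enough. For smaller i the factor -(2i+3) in `evenVars` is undone.
  red-even : ∀ i → Red (var (1 ℕ.+ 2 ℕ.* i))
  red-even i with n ℕ.≤? i
  ... | yes n≤i = red-large {2 ℕ.+ 2 ℕ.* i} (ℕ.≤-trans n≤i (ℕ.≤-trans (ℕ.m≤m+n i _) (ℕ.m≤n+m (2 ℕ.* i) 2)))
  ... | no  n≰i = red-cong unscale (red-poly (const (ℚ.- (+ 1 / (3 ℕ.+ 2 ℕ.* i))) * var x))
    where
    x = fromℕ< (ℕ.≰⇒> n≰i)
    r = + 1 / (3 ℕ.+ 2 ℕ.* i)
    v = var (1 ℕ.+ 2 ℕ.* i)
    unscale : (const (ℚ.- r) * var x) [ evenVars ] ≈ v
    unscale = ≈-trans (R.*-congˡ (≡⇒≈ (cong (λ j → const (ℚ.- ((3 ℕ.+ 2 ℕ.* j) /1)) * var (1 ℕ.+ 2 ℕ.* j)) {toℕ x} {i} (Fin.toℕ-fromℕ< (ℕ.≰⇒> n≰i)))))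
      (≈-trans (≈-sym (*-assoc _ _ _)) (≈-trans
        (R.*-congʳ (≈-trans (≈-sym (const-* _ _)) (≈-trans (≡⇒≈ (cong const (solve 2 (λ a b → (:- a) :* (:- b) := a :* b) refl r ((3 ℕ.+ 2 ℕ.* i) /1))))
          (const-* _ _))))
        (≈-trans (*-assoc _ _ _) (const-inverse (2 ℕ.+ 2 ℕ.* i) v))))

  -- Downward induction on the index, from the range where e_j lies in 𝓘 n; `d` bounds the distance
  -- to it. For even j, β_j expresses e_{j+1} through e_{j+2}, e_{j+3}, ....
  red-e : ∀ j → Red (e j)
  red-e j = downwards n j (ℕ.m≤n+m n j)
    where
    downwards : ∀ d j → n ≤ j ℕ.+ d → Red (e j)
    downwards zero    j       n≤j = red-large {j} (subst (n ≤_) (ℕ.+-identityʳ j) n≤j)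
    downwards (suc d) zero    n≤j = red-const 1ℚ
    downwards (suc d) (suc j) n≤j with parity j | n ℕ.≤? suc j
    ... | inj₂ (i , refl) | _ = red-even i
    ... | inj₁ _          | yes n≤1+j = red-large n≤1+j
    ... | inj₁ (i , refl) | no  n≰1+j = red-cong (const-inverse j (e (suc j))) (red-* (red-const (+ 1 / suc j))
      (red-cong isolate (red-+ (red-Iβ (β j , gen j , ∼-reflexive leading)) (red-neg (red-Σ< n′ later)))))
      where
      -- The n summands in `at (β j) n` include the two leading ones; n ≥ 2 holds because n > j + 1.
      n′ = n ∸ 2
      rest = Σ< n′ (λ i → βterm j (j ℕ.+ (2 ℕ.+ i)))
      leading : at (β j) n ≈ const (suc j /1) * e (suc j) + rest
      leading = subst (λ k → at (β j) k ≈ const (suc j /1) * e (suc j) + rest)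
        (ℕ.m+[n∸m]≡n (ℕ.≤-trans (s≤s (s≤s z≤n)) (ℕ.≰⇒> n≰1+j))) (β-leading j n′ (-1^-even i))
      later : ∀ i → Red (βterm j (j ℕ.+ (2 ℕ.+ i)))
      later i = red-* (red-const _) (downwards d (j ℕ.+ (2 ℕ.+ i)) (ℕ.≤-trans n≤j (ℕ.≤-trans
        (ℕ.≤-reflexive (trans (cong suc (ℕ.+-suc j d)) (cong (ℕ._+ d) (sym (ℕ.+-comm j 2)))))
        (ℕ.+-monoˡ-≤ d (ℕ.+-monoʳ-≤ j (ℕ.m≤m+n 2 i))))))
      isolate : const (suc j /1) * e (suc j) + rest + - rest ≈ const (suc j /1) * e (suc j)
      isolate = ≈-trans (+-assoc _ _ _) (≈-trans (R.+-congˡ (R.-‿inverseʳ rest)) (R.+-identityʳ _))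

  red : ∀ f → Red f
  red (const c) = red-const c
  red (var k)   = red-e (suc k)
  red (f + g)   = red-+ (red f) (red g)
  red (f * g)   = red-* (red f) (red g)
  red (- f)     = red-neg (red f)

-- The substitution respects the gradings: x_{2i+3} goes to a multiple of e_{2i+2}, whose H-degree
-- is 2i+3.
𝓘-evenVars : ∀ {M n} {r : Poly (Fin M)} → Span (λ xs → n ≤ degree label xs) r → 𝓘 n (r [ evenVars ])
𝓘-evenVars zero m _ = component-0# Hdeg m
𝓘-evenVars (resp eq s) m m<n = ≈-trans (component-cong Hdeg (≈-sym ([]-cong evenVars eq)) m) (𝓘-evenVars s m m<n)
𝓘-evenVars {M} (term c xs n≤d s) m m<n = ≈-trans
  (+-cong (𝓘-*ʳ _ (const c) {mono xs [ evenVars ]} (𝓘-≤ {f = mono xs [ evenVars ]} n≤d (monomial xs)) m m<n) (𝓘-evenVars s m m<n)) (+-identityˡ 0#)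
  where
  monomial : ∀ (xs : List (Fin M)) → 𝓘 (degree label xs) (mono xs [ evenVars ])
  monomial [] m ()
  monomial (i ∷ xs) = 𝓘-* (label i) {f = evenVars i} {g = mono xs [ evenVars ]}
    (𝓘-*ʳ (label i) (const (ℚ.- (label i /1))) {var (1 ℕ.+ 2 ℕ.* toℕ i)} (λ m m<d → ≈-trans (δ-var m) (δ-≢ (label i) m (ℕ.>⇒≢ m<d)))) (monomial xs)
    where
    δ-var : ∀ m → component Hdeg (var (1 ℕ.+ 2 ℕ.* toℕ i)) m ≈ δ (label i) (var (1 ℕ.+ 2 ℕ.* toℕ i)) m
    δ-var m = ≈-refl

-- Congruences between values of a polynomial

eval-integral : ∀ (f : Poly X) → Eventually λ p → ∀ (y : X → ℚ) → (∀ x → Integral p (y x)) → Integral p (eval y f)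
eval-integral (const c) with integral-evalAt (const c)
... | N , i = N , λ p pr b y _ → i p pr b
eval-integral (var x)   = eventually₀ λ p pr y i → i x
eval-integral (f + g)   = eventually₂ (λ p pr F G y i → integral-+ (eval y f) (eval y g) pr (F y i) (G y i))
  (eval-integral f) (eval-integral g)
eval-integral (f * g)   = eventually₂ (λ p pr F G y i → integral-* (eval y f) (eval y g) pr (F y i) (G y i))
  (eval-integral f) (eval-integral g)
eval-integral (- f)     = eventually₁ (λ p pr F y i → integral-neg (eval y f) (F y i)) (eval-integral f)

Congruent : ℕ → (y z : X → ℚ) → Set
Congruent p y z = ∀ x → Integral p (y x) × Integral p (z x) × p ^ 1 ∣ᵖ y x ℚ.- z x

-- The bound on p comes from the coefficients of f alone. It has to be uniform in y and z, since the
-- Bernoulli numbers inserted later change with p.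
eval-congruent : ∀ (f : Poly X) → Eventually λ p → ∀ (y z : X → ℚ) → Congruent p y z → p ^ 1 ∣ᵖ eval y f ℚ.- eval z f
eval-congruent (const c) = eventually₀ λ p pr y z _ → subst (p ^ 1 ∣ᵖ_) (sym (ℚ.+-inverseʳ c)) (∣ᵖ-0 pr 1)
eval-congruent (var x)   = eventually₀ λ p pr y z c → proj₂ (proj₂ (c x))
eval-congruent (f + g)   = eventually₂ (λ p pr F G y z c → subst (p ^ 1 ∣ᵖ_)
    (solve 4 (λ a b c d → (a :- b) :+ (c :- d) := (a :+ c) :- (b :+ d)) refl (eval y f) (eval z f) (eval y g) (eval z g))
    (∣ᵖ-+ pr (F y z c) (G y z c)))
  (eval-congruent f) (eval-congruent g)
eval-congruent (f * g)   = eventually₂ (λ p pr (F , I) (G , J) y z c → subst (p ^ 1 ∣ᵖ_)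
    (solve 4 (λ a b c d → a :* (c :- d) :+ (a :- b) :* d := a :* c :- b :* d) refl (eval y f) (eval z f) (eval y g) (eval z g))
    (∣ᵖ-+ pr (∣ᵖ-*ˡ pr (eval y f) (I y (proj₁ ∘ c)) (G y z c)) (∣ᵖ-*ʳ pr (eval z g) (F y z c) (J z (proj₁ ∘ proj₂ ∘ c)))))
  (both f) (both g)
  where
  both = λ f → eventually₂ (λ p pr F I → F , I) (eval-congruent f) (eval-integral f)
eval-congruent (- f)     = eventually₁ (λ p pr F y z c → subst (p ^ 1 ∣ᵖ_)
    (solve 2 (λ a b → :- (a :- b) := (:- a) :- (:- b)) refl (eval y f) (eval z f)) (∣ᵖ-neg pr (F y z c)))
  (eval-congruent f)

-- Scaling the points contributes all but one of the factors p, and the Bernoulli congruence the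
-- last. The constant in `evenVars` is chosen to make the quotient congruent to the Bernoulli number
-- itself.
evalAt-evenVars : ∀ {M p} (pr : Prime p) → 3 ℕ.+ 2 ℕ.* M ≤ p → (i : Fin M) →
  ∃[ y ] (evalAt (points p) (evenVars i) ≡ (p ℕ.^ label i) /1 ℚ.* y
          × Integral p y × Integral p (B (p ∸ label i)) × p ^ 1 ∣ᵖ y ℚ.- B (p ∸ label i))
evalAt-evenVars {M} {suc n} pr (s≤s b) i = from (esym-recips-bernoulli pr (1 ℕ.+ 2 ℕ.* k) r split even)
  where
  p = suc n
  k = toℕ i
  a = label i /1
  r = n ∸ (3 ℕ.+ 2 ℕ.* k)
  bern = B (p ∸ label i)
  s = esym (2 ℕ.+ 2 ℕ.* k) (recips n)
  q = (p ℕ.^ (2 ℕ.+ 2 ℕ.* k)) /1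
  3+2k≤n : 3 ℕ.+ 2 ℕ.* k ≤ n
  3+2k≤n = ℕ.≤-trans (ℕ.≤-trans (s≤s (ℕ.≤-trans (ℕ.≤-reflexive (sym (ℕ.*-suc 2 k))) (ℕ.*-monoʳ-≤ 2 (Fin.toℕ<n i)))) (ℕ.n≤1+n (1 ℕ.+ 2 ℕ.* M))) b
  split : 2 ℕ.+ 2 ℕ.* k ℕ.+ suc r ≡ n
  split = trans (ℕ.+-suc (2 ℕ.+ 2 ℕ.* k) r) (ℕ.m+[n∸m]≡n 3+2k≤n)
  even : -1^ (2 ℕ.+ 2 ℕ.* k) ≡ 1ℚ
  even = trans (cong -1^_ (sym (ℕ.*-suc 2 k))) (-1^-even (suc k))
  index : suc r ≡ p ∸ label i
  index = sym (trans (cong (_∸ (2 ℕ.+ 2 ℕ.* k)) (sym split)) (ℕ.m+n∸m≡n (2 ℕ.+ 2 ℕ.* k) (suc r)))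
  bern-integral : Integral p bern
  bern-integral = subst (Integral p ∘ B) index (integral-B pr (suc r)
    (s≤s (subst (2 ℕ.+ r ≤_) split (s≤s (ℕ.m≤n+m (suc r) (1 ℕ.+ 2 ℕ.* k))))))
  from : p ^ 2 ∣ᵖ a ℚ.* s ℚ.+ p /1 ℚ.* B (suc r) →
    ∃[ y ] (evalAt (points p) (evenVars i) ≡ (p ℕ.^ label i) /1 ℚ.* y × Integral p y × Integral p bern × p ^ 1 ∣ᵖ y ℚ.- bern)
  -- The congruence reads a s + p B = p² z, so the value -a p^(2k+2) s equals p^(2k+3) (B - p z).
  from (multiple z z-int eq) = bern ℚ.- p /1 ℚ.* z , value
    , integral-+ bern (ℚ.- (p /1 ℚ.* z)) pr bern-integral (integral-neg (p /1 ℚ.* z) pz-int)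
    , bern-integral
    , multiple (ℚ.- z) (integral-neg z z-int) (trans
        (solve 3 (λ b p z → (b :- p :* z) :- b := p :* (:- z)) refl bern (p /1) z)
        (cong (λ m → m /1 ℚ.* (ℚ.- z)) (sym (ℕ.*-identityʳ p))))
    where
    open ≡-Reasoning
    pz-int : Integral p (p /1 ℚ.* z)
    pz-int = integral-* (p /1) z pr (integral-/1 p pr) z-int
    p²-expand : (p ℕ.^ 2) /1 ≡ p /1 ℚ.* p /1
    p²-expand = trans (cong (λ m → (p ℕ.* m) /1) (ℕ.*-identityʳ p)) (/1-* p p)
    value : (ℚ.- a) ℚ.* esym (2 ℕ.+ 2 ℕ.* k) (points p) ≡ (p ℕ.^ label i) /1 ℚ.* (bern ℚ.- p /1 ℚ.* z)
    value = begin
      (ℚ.- a) ℚ.* esym (2 ℕ.+ 2 ℕ.* k) (points p)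
        ≡⟨ cong ((ℚ.- a) ℚ.*_) (esym-points n (2 ℕ.+ 2 ℕ.* k)) ⟩
      (ℚ.- a) ℚ.* (q ℚ.* s)
        ≡⟨ solve 5 (λ a q s p b → (:- a) :* (q :* s) := q :* (p :* b :- (a :* s :+ p :* b))) refl a q s (p /1) bern ⟩
      q ℚ.* (p /1 ℚ.* bern ℚ.- (a ℚ.* s ℚ.+ p /1 ℚ.* bern))
        ≡⟨ cong (λ w → q ℚ.* (p /1 ℚ.* bern ℚ.- w)) (trans (cong (λ j → a ℚ.* s ℚ.+ p /1 ℚ.* B j) (sym index))
             (trans eq (cong (ℚ._* z) p²-expand))) ⟩
      q ℚ.* (p /1 ℚ.* bern ℚ.- p /1 ℚ.* p /1 ℚ.* z)
        ≡⟨ solve 4 (λ q p b z → q :* (p :* b :- p :* p :* z) := (p :* q) :* (b :- p :* z)) refl q (p /1) bern z ⟩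
      p /1 ℚ.* q ℚ.* (bern ℚ.- p /1 ℚ.* z)
        ≡⟨ cong (ℚ._* (bern ℚ.- p /1 ℚ.* z)) (sym (/1-* p (p ℕ.^ (2 ℕ.+ 2 ℕ.* k)))) ⟩
      (p ℕ.^ label i) /1 ℚ.* (bern ℚ.- p /1 ℚ.* z) ∎

-- Write r = h + t with h of degree m and t of higher degree. The image of t lies in 𝓘 (m+1), so
-- p^(m+1) divides the value p^m h(y) of the image of h. Hence p divides h(y), and y is congruent to
-- the Bernoulli numbers.
lowest-component : ∀ {M m} (r : Poly (Fin M)) → (∀ k → k < m → component label r k ≈ 0#) →
  Vanishes (suc m) (r [ evenVars ]) →
  Eventually λ p → p ∣ ∣ ↥ eval (λ i → B (p ∸ label i)) (component label r m) ∣
lowest-component {M} {m} r lower vanishes with tail label (suc m) r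
... | t , t-high , r≈ = eventually₂ combine
    (eventually₂ (λ p pr → ∣ᵖ-minus pr) (eventually vanishes)
      (eventually (vanishes-𝓘 {suc m} {t [ evenVars ]} (𝓘-evenVars t-high))))
    (eventually₂ (λ p pr c b → c , b) (eval-congruent h) (3 ℕ.+ 2 ℕ.* M , λ p pr b → b))
  where
  h = component label r m
  r≈h+t : r ≈ h + t
  r≈h+t = ≈-trans r≈ (R.+-congʳ (≈-trans (R.+-congʳ (Σ<-zero m lower)) (+-identityˡ h)))
  combine : ∀ p → Prime p → p ^ suc m ∣ᵖ evalAt (points p) (r [ evenVars ]) ℚ.- evalAt (points p) (t [ evenVars ]) →
    (∀ y z → Congruent p y z → p ^ 1 ∣ᵖ eval y h ℚ.- eval z h) × 3 ℕ.+ 2 ℕ.* M ≤ p →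
    p ∣ ∣ ↥ eval (λ i → B (p ∸ label i)) h ∣
  combine p pr divisible (congruent , b) = subst (_∣ ∣ ↥ eval bern h ∣) (ℕ.*-identityʳ p) (∣ᵖ⇒∣↥ pr
    (subst (p ^ 1 ∣ᵖ_) (solve 2 (λ u v → u :- (u :- v) := v) refl (eval y h) (eval bern h))
      (∣ᵖ-minus pr (∣ᵖ-cancel pr m (subst (p ^ m ℕ.+ 1 ∣ᵖ_) value (subst (λ k → p ^ k ∣ᵖ eval ρ (r [ evenVars ]) ℚ.- y′) (ℕ.+-comm 1 m) divisible)))
        (congruent y bern λ i → proj₂ (proj₂ (evalAt-evenVars pr b i))))))
    where
    y bern : Fin M → ℚ
    y i    = proj₁ (evalAt-evenVars pr b i)
    bern i = B (p ∸ label i)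
    ρ = λ k → esym (suc k) (points p)
    x y′ : ℚ
    x = eval ρ (h [ evenVars ])
    y′ = eval ρ (t [ evenVars ])
    value : eval ρ (r [ evenVars ]) ℚ.- y′ ≡ (p ℕ.^ m) /1 ℚ.* eval y h
    value = begin
      eval ρ (r [ evenVars ]) ℚ.- y′   ≡⟨ cong (ℚ._- y′) (eval-cong ρ ([]-cong evenVars r≈h+t)) ⟩
      x ℚ.+ y′ ℚ.- y′                  ≡⟨ solve 2 (λ x y → x :+ y :- y := x) refl x y′ ⟩
      x                                ≡⟨ eval-[] ρ evenVars h ⟩
      eval (eval ρ ∘ evenVars) h       ≡⟨ eval-ext (λ i → proj₁ (proj₂ (evalAt-evenVars pr b i))) h ⟩
      eval (λ i → (p ℕ.^ label i) /1 ℚ.* y i) h ≡⟨ eval-homogeneous label p y (span-component label r m) ⟩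
      (p ℕ.^ m) /1 ℚ.* eval y h        ∎
      where open ≡-Reasoning

-- The kernel under (BC)

components-vanish : BC → ∀ {M n} (r : Poly (Fin M)) → 1 ≤ M → Vanishes n (r [ evenVars ]) →
                    ∀ m → m < n → component label r m ≈ 0#
components-vanish bc {M} {n} r 1≤M vanishes m m<n = below (suc m) m ℕ.≤-refl m<n
  where
  below : ∀ k m → m < k → m < n → component label r m ≈ 0#
  -- A nonzero h would have, by (BC), a prime p ≥ N not dividing its value, against the previous
  -- lemma; this gives the double negation only.
  below (suc k) m (s≤s m≤k) m<n = ≈0-stable h λ h≉0 →
    let N , p∣h              = lowest-component r (λ j j<m → below k j (ℕ.<-≤-trans j<m m≤k) (ℕ.<-trans j<m m<n))
                                 (vanishes-weaken m<n vanishes)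
        p , N≤p , pr , p∤h   = bc M 1≤M h h≉0 (m , component-homogeneous label r m) N
    in p∤h (p∣h p pr N≤p)
    where h = component label r m

KerẐ⊆Closure : BC → KerẐ ⊆ Closure Iβ
-- Level 0 imposes no condition. It is treated apart because the reduction at level n uses n
-- variables and (BC) asks for at least one.
KerẐ⊆Closure bc {f} f∈ zero = ι 0# , zero , λ m ()
KerẐ⊆Closure bc {f} f∈ n@(suc _) with red n (at f n)
... | reducible {g} r g∈ eq =
  let v            = vanishes-cong cancel (vanishes-+ (KerẐ⇒vanishes {f} f∈ n) (vanishes-neg (vanishes-Iβ-mod g∈)))
      -- All components of r below degree n are zero, so its image lies in 𝓘 n and f is left in I_β
      -- + 𝓘 n.
      r∈           = 𝓘-evenVars {r = r} (span≥ label (components-vanish bc r (s≤s z≤n) v))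
      ĝ , ĝ∈ , ĝ∼f = Iβ-mod-cong (≈-sym eq) (Iβ-mod-+ g∈ (Iβ-mod-𝓘 r∈))
  in ĝ , ĝ∈ , ∼⇒mod𝓘 ĝ∼f
  where
  cancel : at f n + - g ≈ r [ evenVars ]
  cancel = ≈-trans (R.+-congʳ (≈-trans eq (+-comm _ _))) (≈-trans (+-assoc _ _ _)
    (≈-trans (R.+-congˡ (R.-‿inverseʳ g)) (R.+-identityʳ _)))

theorem6p1 : BC → KerẐ ≐ Closure Iβ
theorem6p1 bc = (λ {f} → KerẐ⊆Closure bc {f}) , (λ {f} → Closure⊆KerẐ {f})
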